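{- Let $d\ge 2$, let $p$ be a prime with $d\mid(p-1)$, and let $q$ be a power of $p$. Then $MD_d(\lambda,\mathbb{F}_q)\le\sqrt{2(q-1)/d}+4$ for every $\lambda\in\mathbb{F}_q^*$.
   Context: $S_d=\{x^d:x\in\mathbb{F}_q^*\}$. A set of distinct elements $a_1,\dots,a_m$ of $\mathbb{F}_q^*$ has property $D_d(\lambda,\mathbb{F}_q)$ if $a_ia_j+\lambda\in S_d\cup\{0\}$ whenever $i\ne j$; $MD_d(\lambda,\mathbb{F}_q)$ is the maximum size of a subset of $\mathbb{F}_q^*$ with this property. -}

module Defs where

open import Data.Nat using (ℕ; zero; suc)
open import Data.Fin using (Fin)
open import Data.Product using (Σ; ∃; _×_)
open import Data.Sum using (_⊎_)
open import Relation.Nullary using (¬_)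
open import Relation.Binary.PropositionalEquality using (_≡_)
open import Algebra.Core using (Op₁; Op₂)
open import Algebra.Structures using (IsCommutativeRing)
open import Function.Bundles using (_↔_)

record FiniteField (q : ℕ) : Set₁ where
  field
    Carrier : Set
    _+_ _*_ : Op₂ Carrier
    -_ : Op₁ Carrier
    0# 1# : Carrier
    isCommutativeRing : IsCommutativeRing _≡_ _+_ _*_ -_ 0# 1#
    0≢1 : ¬ (0# ≡ 1#)
    inverse : ∀ x → ¬ (x ≡ 0#) → ∃ λ y → (x * y) ≡ 1#
    card : Carrier ↔ Fin q

  _^_ : Carrier → ℕ → Carrier
  x ^ zero = 1#
  x ^ suc n = x * (x ^ n)

  InS : ℕ → Carrier → Set
  InS d x = ∃ λ y → ¬ (y ≡ 0#) × (y ^ d) ≡ x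

  HasD : (d : ℕ) (lam : Carrier) (m : ℕ) → (Fin m → Carrier) → Set
  HasD d lam m a =
    (∀ i j → a i ≡ a j → i ≡ j) ×
    (∀ i → ¬ (a i ≡ 0#)) ×
    (∀ i j → ¬ (i ≡ j) → InS d ((a i * a j) + lam) ⊎ ((a i * a j) + lam) ≡ 0#)

{-# OPTIONS --safe #-}
-- Stepanov's method.  Let N = (q − 1)/d and suppose that 2R + 2 of the given elements, call them
-- b_i, satisfy 2R² > N.  With c_i the coefficients of the divided difference at the points b_i, put
--   f = Σ c_i (X − b_i)^r (b_i X + λ)^(N + M),   R ≤ r,  M + r ≤ 2R.
-- For i ≠ j the N-th power of b_i b_j + λ is 1 unless b_i b_j + λ = 0, while (X − b_j)^r takes care
-- of the term i = j; hence f vanishes to order R at every b_j.  Its degree is at most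
-- N + 2R < (2R + 2)R, so f = 0.  But M and r can be read off the base-p digits of R so that some
-- coefficient of f is a unit times two binomial coefficients prime to p: this uses that
-- all digits of N are equal to (p − 1)/d ≤ (p − 1)/2.
module Submission where

open import Algebra.Bundles using (CommutativeRing)
open import Algebra.Structures using (IsCommutativeRing)
open import Data.Empty using (⊥)
open import Data.Fin using (Fin; zero; suc; toℕ)
import Data.Fin.Properties as Fin
open import Data.Nat as ℕ using (ℕ; zero; suc; _≤_; _<_; _∸_; z≤n; s≤s)
open import Data.Nat.Combinatorics using (_C_; k>n⇒nCk≡0; nCk+nC[k+1]≡[n+1]C[k+1])
import Data.Nat.Properties as ℕ
open import Data.Product using (∃; ∃₂; _×_; _,_; proj₁; proj₂)
open import Data.Sum as Sum using (_⊎_; inj₁; inj₂; [_,_]′)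
import Data.Vec.Functional as Vector
open import Function using (_∘_)
open import Level using (_⊔_; 0ℓ)
open import Relation.Nullary using (¬_; yes; no; contradiction)
open import Relation.Binary.PropositionalEquality as ≡ using (_≡_)

-- Around `b j` one has b_i X + λ = b_i (X - b_j) + (b_i b_j + λ). After the N-th power is dropped,
-- the part of order k < M is a polynomial of degree at most M + r in b_i, and the divided
-- difference kills it because M + r ≤ 2R. An order k with M ≤ k < R is harmless only if p divides
-- C(N + M, k). The plain choice M = r = R leaves no such k, but the first surviving moment, of
-- index 2R + 1, then comes with C(N + R, R + 1), which p may divide once R and N carry in base p.
-- The remedy is to lower M until N + M is a multiple of a power P of p. Its binomial coefficients
-- vanish mod p away from the multiples of P; this disposes of the orders M ≤ k < R and also
-- isolates one term of a coefficient of f. The price is a larger r with a binomial coefficient of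
-- its own to be kept prime to p. The constant 4: let w = m - 4 and R = ⌊w/2⌋ + 1. Then 2R ≥ w, so
-- w² > 2N gives 2R² > N, while 2R + 2 ≤ w + 4 = m.

module Arithmetic where

  open import Data.Nat
  open import Data.Nat.Properties
  open import Data.Nat.Combinatorics using (_C_; nCk≡n!/k![n-k]!; k![n∸k]!∣n!; k>n⇒nCk≡0)
  open import Data.Nat.Divisibility
  open import Data.Nat.DivMod using (m/n*n≡m; m≡m%n+[m/n]*n; m%n<n)
  open import Data.Nat.Primality using (Prime; prime⇒nonTrivial; euclidsLemma)
  open import Data.Nat.Tactic.RingSolver using (solve-∀)
  open import Relation.Binary.PropositionalEquality

  -- Factorial identities for binomial coefficients over ℕ.

  C-factorial : ∀ a b → ((a + b) C a) * (a ! * b !) ≡ (a + b) !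
  C-factorial a b = begin
    ((a + b) C a) * (a ! * b !)             ≡⟨ cong (λ z → ((a + b) C a) * (a ! * z !)) (m+n∸m≡n a b) ⟨
    ((a + b) C a) * (a ! * (a + b ∸ a) !)   ≡⟨ cong (_* (a ! * (a + b ∸ a) !)) (nCk≡n!/k![n-k]! (m≤m+n a b)) ⟩
    (a + b) ! / (a ! * (a + b ∸ a) !) * (a ! * (a + b ∸ a) !)
                                            ≡⟨ m/n*n≡m (k![n∸k]!∣n! (m≤m+n a b)) ⟩
    (a + b) !                               ∎
    where
    open ≡-Reasoning
    instance _ = a !* (a + b ∸ a) !≢0

  C-absorption : ∀ a b → suc a * ((suc a + b) C suc a) ≡ (suc a + b) * ((a + b) C a)
  C-absorption a b = *-cancelʳ-≡ _ _ (a ! * b !) {{a !* b !≢0}} (begin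
    suc a * ((suc a + b) C suc a) * (a ! * b !)     ≡⟨ lemma (suc a) ((suc a + b) C suc a) (a !) (b !) ⟩
    ((suc a + b) C suc a) * (suc a ! * b !)         ≡⟨ C-factorial (suc a) b ⟩
    (suc a + b) * (a + b) !                         ≡⟨ cong ((suc a + b) *_) (C-factorial a b) ⟨
    (suc a + b) * (((a + b) C a) * (a ! * b !))     ≡⟨ *-assoc (suc a + b) ((a + b) C a) (a ! * b !) ⟨
    (suc a + b) * ((a + b) C a) * (a ! * b !)       ∎)
    where
    open ≡-Reasoning
    lemma : ∀ s c f g → s * c * (f * g) ≡ c * (s * f * g)
    lemma = solve-∀

  -- Transfers non-divisibility by p from C(N + R, R) to C(N + R, R + 1) when p does not divide N.
  C-raise : ∀ n r → suc r * ((n + r) C suc r) ≡ n * ((n + r) C r)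
  C-raise zero r = trans (cong (suc r *_) (k>n⇒nCk≡0 (n<1+n r))) (*-zeroʳ (suc r))
  C-raise (suc n) r = *-cancelʳ-≡ _ _ (r ! * n !) {{r !* n !≢0}} (begin
    suc r * ((suc n + r) C suc r) * (r ! * n !)   ≡⟨ cong (λ z → suc r * (z C suc r) * (r ! * n !)) (cong suc (+-comm n r)) ⟩
    suc r * ((suc r + n) C suc r) * (r ! * n !)   ≡⟨ lemma (suc r) ((suc r + n) C suc r) (r !) (n !) ⟩
    ((suc r + n) C suc r) * (suc r ! * n !)       ≡⟨ C-factorial (suc r) n ⟩
    (suc r + n) !                                 ≡⟨ cong _! (+-suc r n) ⟨
    (r + suc n) !                                 ≡⟨ C-factorial r (suc n) ⟨
    ((r + suc n) C r) * (r ! * suc n !)           ≡⟨ cong (λ z → (z C r) * (r ! * suc n !)) (+-comm r (suc n)) ⟩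
    ((suc n + r) C r) * (r ! * suc n !)           ≡⟨ lemma′ (suc n) ((suc n + r) C r) (r !) (n !) ⟩
    suc n * ((suc n + r) C r) * (r ! * n !)       ∎)
    where
    open ≡-Reasoning
    lemma : ∀ s c f g → s * c * (f * g) ≡ c * (s * f * g)
    lemma = solve-∀
    lemma′ : ∀ s c f g → c * (f * (s * g)) ≡ s * c * (f * g)
    lemma′ = solve-∀

  -- The number (p^j - 1)/(p - 1), written with j digits 1 in base p. Its multiple by e < p has all
  -- j digits equal to e.
  repunit : ℕ → ℕ → ℕ
  repunit p zero    = 0
  repunit p (suc j) = p ^ j + repunit p j

  repunit-^ : ∀ p′ j → p′ * repunit (suc p′) j + 1 ≡ suc p′ ^ j
  repunit-^ p′ zero    = cong (_+ 1) (*-zeroʳ p′)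
  repunit-^ p′ (suc j) = begin
    p′ * (P + E) + 1      ≡⟨ lemma p′ P E ⟩
    p′ * P + (p′ * E + 1) ≡⟨ cong (p′ * P +_) (repunit-^ p′ j) ⟩
    p′ * P + P            ≡⟨ +-comm (p′ * P) P ⟩
    suc p′ * P            ∎
    where
    open ≡-Reasoning
    P = suc p′ ^ j
    E = repunit (suc p′) j
    lemma : ∀ a b c → a * (b + c) + 1 ≡ a * b + (a * c + 1)
    lemma = solve-∀

  -- Binomial coefficients modulo a prime, digit by digit.

  module ModPrime (p′ : ℕ) (prime : Prime (suc p′)) where

    p : ℕ
    p = suc p′

    p∤1 : ¬ p ∣ 1
    p∤1 p∣1 = contradiction (∣1⇒≡1 p∣1) (nonTrivial⇒≢1 {{prime⇒nonTrivial prime}})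

    p∤* : ∀ {a b} → ¬ p ∣ a → ¬ p ∣ b → ¬ p ∣ a * b
    p∤* {a} {b} p∤a p∤b p∣ab = [ p∤a , p∤b ]′ (euclidsLemma a b prime p∣ab)

    p∤residue : ∀ A b → suc b < p → ¬ p ∣ A * p + suc b
    p∤residue A b b<p p∣ = <⇒≱ b<p (∣⇒≤ (∣m+n∣m⇒∣n p∣ (n∣m*n A)))

    -- The multiples of p up to Ap + b are p, 2p, ..., Ap, with product p^A A!; all other factors
    -- are prime to p.
    factorial-unit : ∀ A b → b < p → ∃ λ u → ¬ p ∣ u × (A * p + b) ! ≡ p ^ A * A ! * u
    factorial-unit zero    zero    b<p = 1 , p∤1 , refl
    factorial-unit (suc A) zero    _   with factorial-unit A p′ (n<1+n p′)
    ... | u , p∤u , eq = u , p∤u , (begin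
      (suc A * p + 0) !                ≡⟨ cong _! (trans (+-identityʳ _) (cong suc (+-comm p′ (A * p)))) ⟩
      suc (A * p + p′) * (A * p + p′) ! ≡⟨ cong (suc (A * p + p′) *_) eq ⟩
      suc (A * p + p′) * (p ^ A * A ! * u) ≡⟨ lemma A p′ (p ^ A) (A !) u ⟩
      p ^ suc A * suc A ! * u          ∎)
      where
      open ≡-Reasoning
      lemma : ∀ a q x y u → suc (a * suc q + q) * (x * y * u) ≡ suc q * x * (suc a * y) * u
      lemma = solve-∀
    factorial-unit A       (suc b) b<p with factorial-unit A b (<-trans (n<1+n b) b<p)
    ... | u , p∤u , eq = (A * p + suc b) * u , p∤* (p∤residue A b b<p) p∤u , (begin
      (A * p + suc b) !                 ≡⟨ cong _! (+-suc (A * p) b) ⟩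
      suc (A * p + b) * (A * p + b) !   ≡⟨ cong₂ _*_ (sym (+-suc (A * p) b)) eq ⟩
      (A * p + suc b) * (p ^ A * A ! * u) ≡⟨ lemma (A * p + suc b) (p ^ A * A !) u ⟩
      p ^ A * A ! * ((A * p + suc b) * u) ∎)
      where
      open ≡-Reasoning
      lemma : ∀ a x u → a * (x * u) ≡ x * (a * u)
      lemma = solve-∀

    -- By Kummer's theorem this says that a and b add without carry in base p.
    Indivisible : ℕ → ℕ → Set
    Indivisible a b = ¬ p ∣ (a + b) C a

    -- Since b + x < p, the sum has exactly A + D as its higher part. So `factorial-unit` extracts
    -- the same power of p on both sides of the factorial formula, and what remains is C(A + D, A)
    -- up to factors prime to p.
    lucas-step : ∀ A D b x → b + x < p → Indivisible A D → Indivisible (A * p + b) (D * p + x)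
    lucas-step A D b x b+x<p p∤AD p∣X
      with u , _ , equ ← factorial-unit A b (≤-<-trans (m≤m+n b x) b+x<p)
         | v , _ , eqv ← factorial-unit D x (≤-<-trans (m≤n+m x b) b+x<p)
         | w , p∤w , eqw ← factorial-unit (A + D) (b + x) b+x<p
      = p∤* p∤AD p∤w (subst (p ∣_) cancelled (∣m⇒∣m*n (u * v) p∣X))
      where
      X = ((A * p + b) + (D * p + x)) C (A * p + b)
      Y = (A + D) C A
      instance
        p^A≢0 = m^n≢0 p A
        p^D≢0 = m^n≢0 p D
        A!D!≢0 = A !* D !≢0
      lemma₁ : ∀ X pa fa u pd fd v → X * (u * v) * (pa * pd * (fa * fd)) ≡ X * (pa * fa * u * (pd * fd * v))
      lemma₁ = solve-∀
      lemma₂ : ∀ A D p b x → (A * p + b) + (D * p + x) ≡ (A + D) * p + (b + x)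
      lemma₂ = solve-∀
      lemma₃ : ∀ pa pd Y f w → pa * pd * (Y * f) * w ≡ Y * w * (pa * pd * f)
      lemma₃ = solve-∀
      open ≡-Reasoning
      cancelled : X * (u * v) ≡ Y * w
      cancelled = *-cancelʳ-≡ _ _ (p ^ A * p ^ D * (A ! * D !))
        {{m*n≢0 _ _ {{m*n≢0 (p ^ A) (p ^ D)}}}} (begin
        X * (u * v) * (p ^ A * p ^ D * (A ! * D !))          ≡⟨ lemma₁ X (p ^ A) (A !) u (p ^ D) (D !) v ⟩
        X * (p ^ A * A ! * u * (p ^ D * D ! * v))            ≡⟨ cong (X *_) (cong₂ _*_ equ eqv) ⟨
        X * ((A * p + b) ! * (D * p + x) !)                  ≡⟨ C-factorial (A * p + b) (D * p + x) ⟩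
        ((A * p + b) + (D * p + x)) !                        ≡⟨ cong _! (lemma₂ A D p b x) ⟩
        ((A + D) * p + (b + x)) !                            ≡⟨ eqw ⟩
        p ^ (A + D) * (A + D) ! * w                          ≡⟨ cong₂ (λ r s → r * s * w) (^-distribˡ-+-* p A D) (sym (C-factorial A D)) ⟩
        p ^ A * p ^ D * (Y * (A ! * D !)) * w                ≡⟨ lemma₃ (p ^ A) (p ^ D) Y (A ! * D !) w ⟩
        Y * w * (p ^ A * p ^ D * (A ! * D !))                ∎)

    -- Lucas' theorem as a definition: a and b, written with j base-p digits, add without carry,
    -- so prepending them to A and B keeps the binomial coefficient prime to p.
    CarryFree : ℕ → ℕ → ℕ → Set
    CarryFree j a b = ∀ A B → Indivisible A B → Indivisible (A * p ^ j + a) (B * p ^ j + b)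

    carryFree-0 : CarryFree 0 0 0
    carryFree-0 A B p∤ = subst₂ Indivisible (eq A) (eq B) p∤
      where
      eq : ∀ A → A ≡ A * 1 + 0
      eq = solve-∀

    carryFree-digit : ∀ j {a b} x y → x + y < p → CarryFree j a b →
                      CarryFree (suc j) (x * p ^ j + a) (y * p ^ j + b)
    carryFree-digit j {a} {b} x y x+y<p cf A B p∤ =
      subst₂ Indivisible (eq A x a) (eq B y b)
        (cf (A * p + x) (B * p + y) (lucas-step A B x y x+y<p p∤))
      where
      lemma : ∀ A p x P a → (A * p + x) * P + a ≡ A * (p * P) + (x * P + a)
      lemma = solve-∀
      eq : ∀ A x a → (A * p + x) * p ^ j + a ≡ A * p ^ suc j + (x * p ^ j + a)
      eq A x a = lemma A p x (p ^ j) a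

    digit : ∀ c j x → x < c * p ^ j → ∃₂ λ x₁ x₀ → x ≡ x₁ * p ^ j + x₀ × x₀ < p ^ j × x₁ < c
    digit c j x x<cP =
      _ , _ , eq , m%n<n x (p ^ j) ,
      *-cancelʳ-< (p ^ j) (x / p ^ j) c (≤-<-trans (≤-trans (m≤m+n _ _) (≤-reflexive (sym eq))) x<cP)
      where
      instance _ = m^n≢0 p j
      eq : x ≡ x / p ^ j * p ^ j + x % p ^ j
      eq = trans (m≡m%n+[m/n]*n x (p ^ j)) (+-comm (x % p ^ j) _)

    carryFree-0ˡ : ∀ j b → b < p ^ j → CarryFree j 0 b
    carryFree-0ˡ zero    zero    _       = carryFree-0
    carryFree-0ˡ zero    (suc b) (s≤s ())
    carryFree-0ˡ (suc j) b       b<P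
      with y , b₀ , refl , b₀<P , y<p ← digit p j b b<P
      = carryFree-digit j 0 y y<p (carryFree-0ˡ j b₀ b₀<P)

    -- All digits of p^j - 1 are p - 1, so the digits of a are the complements of those of b and no
    -- column carries.
    carryFree-complement : ∀ j a b → suc (a + b) ≡ p ^ j → CarryFree j a b
    carryFree-complement zero    zero zero refl = carryFree-0
    carryFree-complement (suc j) a b eq
      with x , b₀ , refl , b₀<P , x<p ← digit p j b (subst (b <_) eq (s≤s (m≤n+m b a)))
      with y , x+y≡p′ ← m≤n⇒∃[o]m+o≡n (≤-pred x<p)
         | a₀ , b₀+a₀≡P ← m≤n⇒∃[o]m+o≡n b₀<P
      = subst (λ a → CarryFree (suc j) a (x * p ^ j + b₀)) (sym a≡)
          (carryFree-digit j y x (s≤s (≤-reflexive (trans (+-comm y x) x+y≡p′)))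
            (carryFree-complement j a₀ b₀ (trans (cong suc (+-comm a₀ b₀)) b₀+a₀≡P)))
      where
      P = p ^ j
      lemma : ∀ y P a₀ x b₀ → suc (y * P + a₀ + (x * P + b₀)) ≡ (x + y) * P + (suc b₀ + a₀)
      lemma = solve-∀
      open ≡-Reasoning
      a≡ : a ≡ y * P + a₀
      a≡ = +-cancelʳ-≡ (x * P + b₀) _ _ (suc-injective (begin
        suc (a + (x * P + b₀))             ≡⟨ eq ⟩
        P + p′ * P                         ≡⟨ cong₂ _+_ (sym b₀+a₀≡P) (cong (_* P) (sym x+y≡p′)) ⟩
        suc b₀ + a₀ + (x + y) * P          ≡⟨ +-comm (suc b₀ + a₀) _ ⟩
        (x + y) * P + (suc b₀ + a₀)        ≡⟨ lemma y P a₀ x b₀ ⟨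
        suc (y * P + a₀ + (x * P + b₀))    ∎))

    pow-coprime : ∀ j {c} → ¬ p ∣ c → ∀ {l} → p ^ j ∣ l * c → p ^ j ∣ l
    pow-coprime zero    p∤c {l} _  = 1∣ l
    pow-coprime (suc j) {c} p∤c {l} d with euclidsLemma l c prime (∣-trans (m∣m*n (p ^ j)) d)
    ... | inj₂ p∣c = contradiction p∣c p∤c
    ... | inj₁ (divides m refl) = subst (_∣ m * p) (*-comm (p ^ j) p)
            (*-monoˡ-∣ p (pow-coprime j p∤c {m}
              (*-cancelˡ-∣ p (subst (p ^ suc j ∣_) (lemma m p c) d))))
      where
      lemma : ∀ m p c → m * p * c ≡ p * (m * c)
      lemma = solve-∀

    -- With n = Z p^j, the identity l C(n, l) = n C(n - 1, l - 1) makes p^j divide l C(n, l). If p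
    -- did not divide C(n, l), then p^j would divide l.
    p∣C : ∀ j Z l → ¬ p ^ j ∣ l → p ∣ ((Z * p ^ j) C l)
    p∣C j Z zero    P∤l = contradiction ((p ^ j) ∣0) P∤l
    p∣C j Z (suc l) P∤l with p ∣? ((Z * p ^ j) C suc l)
    ... | yes p∣ = p∣
    ... | no  p∤ with suc l ≤? Z * p ^ j
    ...   | no  l≰ = subst (p ∣_) (sym (k>n⇒nCk≡0 (≰⇒> l≰))) (p ∣0)
    ...   | yes l≤ with b , l+b≡ ← m≤n⇒∃[o]m+o≡n l≤ =
      contradiction (pow-coprime j p∤ (divides (Z * c) (begin
        suc l * ((Z * p ^ j) C suc l) ≡⟨ cong (λ n → suc l * (n C suc l)) l+b≡ ⟨
        suc l * ((suc l + b) C suc l) ≡⟨ C-absorption l b ⟩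
        (suc l + b) * c               ≡⟨ cong (_* c) l+b≡ ⟩
        Z * p ^ j * c                 ≡⟨ lemma Z (p ^ j) c ⟩
        Z * c * p ^ j                 ∎))) P∤l
      where
      c = (l + b) C l
      open ≡-Reasoning
      lemma : ∀ Z P c → Z * P * c ≡ Z * c * P
      lemma = solve-∀

    -- v + s is the exponent r of the header; the binomial coefficients prime to p are those in the
    -- coefficient of X^(v + t), and high-order removes its other contributions.
    record Exponents (N R : ℕ) : Set where
      field
        M v s t : ℕ
        low-order : ∀ k → k < R → k < M ⊎ p ∣ ((N + M) C k)
        p∤C[t] : ¬ p ∣ ((N + M) C t)
        p∤C[v] : Indivisible v s
        s+t≡1+2R : s + t ≡ suc (R + R)
        high-order : ∀ l → t < l → l ≤ t + v → p ∣ ((N + M) C l)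
        M+v+s≤2R : M + (v + s) ≤ R + R
        R≤v+s : R ≤ v + s

    -- Choice of the exponents from the base-p digits of R.

    module _ (e : ℕ) (1≤e : 1 ≤ e) (2e≤p′ : e + e ≤ p′) where

      ε : ℕ → ℕ
      ε = repunit p

      -- From 2e ≤ p - 1 and (p - 1) `ε j` = p^j - 1.
      2eε<p^j : ∀ j → e * ε j + e * ε j < p ^ j
      2eε<p^j j = begin-strict
        e * ε j + e * ε j ≡⟨ *-distribʳ-+ (ε j) e e ⟨
        (e + e) * ε j     ≤⟨ *-monoˡ-≤ (ε j) 2e≤p′ ⟩
        p′ * ε j          <⟨ n<1+n _ ⟩
        suc (p′ * ε j)    ≡⟨ +-comm 1 (p′ * ε j) ⟩
        p′ * ε j + 1      ≡⟨ repunit-^ p′ j ⟩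
        p ^ j             ∎
        where open ≤-Reasoning

      eε<p^j : ∀ j → e * ε j < p ^ j
      eε<p^j j = ≤-<-trans (m≤m+n _ _) (2eε<p^j j)

      -- 2y = z + (2y − z) is to be carry-free; σ is the complement p ^ j − 1 − 2y, in terms of which
      -- this says that z and σ add without carry.
      double-split : ∀ j y → y < e * ε j →
        ∃₂ λ z σ → y ≤ z × z < e * ε j × suc (y + y + σ) ≡ p ^ j × CarryFree j z σ
      double-split zero    y y<   = contradiction (subst (y <_) (*-zeroʳ e) y<) λ ()
      double-split (suc j) y y< with y + y <? e * ε (suc j)
      -- Here z = 2y is small enough, and 2y = 2y + 0 has no carry.
      ... | yes 2y<
        with σ , eq ← m≤n⇒∃[o]m+o≡n (<-trans 2y< (eε<p^j (suc j)))
        = y + y , σ , m≤m+n y y , 2y< , eq , carryFree-complement (suc j) (y + y) σ eq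
      ... | no 2y≮ with y <? e * p ^ j
      -- The leading digit of y is e. Let z begin with e too and σ with f = p - 1 - 2e; as e + f <
      -- p, the lower digits can be settled by recursion.
      double-split (suc j) y y< | no 2y≮ | no y≮
        with y′ , refl ← m≤n⇒∃[o]m+o≡n (≮⇒≥ y≮)
        with z , σ , y′≤z , z< , eq , cf ← double-split j y′
               (+-cancelˡ-< (e * p ^ j) _ _ (subst (e * p ^ j + y′ <_) (*-distribˡ-+ e (p ^ j) (ε j)) y<))
        with f , refl ← m≤n⇒∃[o]m+o≡n 2e≤p′
        = e * p ^ j + z , f * p ^ j + σ , +-monoʳ-≤ _ y′≤z ,
          subst (e * p ^ j + z <_) (sym (*-distribˡ-+ e (p ^ j) (ε j))) (+-monoʳ-< (e * p ^ j) z<) ,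
          trans (lemma e (p ^ j) y′ f σ) (cong (_+ (e + e + f) * p ^ j) eq) ,
          carryFree-digit j e f (s≤s (+-monoˡ-≤ f (m≤m+n e e))) cf
        where
        lemma : ∀ e P y f σ → suc (e * P + y + (e * P + y) + (f * P + σ)) ≡ suc (y + y + σ) + (e + e + f) * P
        lemma = solve-∀
      -- With a single digit z = y suffices, because y + σ ≤ 2y + σ = p - 1.
      double-split (suc zero) y y< | no _ | yes y<e
        with σ , eq ← m≤n⇒∃[o]m+o≡n (≤-<-trans (+-mono-≤ (<⇒≤ y<) (<⇒≤ y<)) (2eε<p^j 1))
        = y , σ , ≤-refl , y< , eq ,
          subst₂ (CarryFree 1) (lemma y) (lemma σ)
            (carryFree-digit 0 y σ (≤-trans (s≤s (+-monoˡ-≤ σ (m≤m+n y y))) (≤-reflexive (trans eq (*-identityʳ p)))) carryFree-0)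
        where
        lemma : ∀ y → y * 1 + 0 ≡ y
        lemma = solve-∀
      -- Take z with leading digit e and zeros below. It exceeds y, and it is smaller than e
      -- `ε (suc (suc i))`, which has a further digit e. The leading digit of 2y is at least e, so
      -- that of σ is less than p - e.
      double-split (suc (suc i)) y y< | no 2y≮ | yes y<eP
        with σ , eq ← m≤n⇒∃[o]m+o≡n (≤-<-trans (+-mono-≤ (<⇒≤ y<) (<⇒≤ y<)) (2eε<p^j (suc (suc i))))
        with f , e+f≡p ← m≤n⇒∃[o]m+o≡n (≤-trans (≤-trans (m≤m+n e e) 2e≤p′) (n≤1+n p′))
        with x , σ₀ , refl , σ₀<P , x<f ← digit f (suc i) σ (+-cancelˡ-< (e * p ^ suc i) _ _ (let open ≤-Reasoning in begin-strict
                 e * p ^ suc i + σ              ≤⟨ +-monoˡ-≤ σ (≤-trans (*-monoʳ-≤ e (m≤m+n (p ^ suc i) _)) (≮⇒≥ 2y≮)) ⟩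
                 y + y + σ                      <⟨ n<1+n _ ⟩
                 suc (y + y + σ)                ≡⟨ eq ⟩
                 p * p ^ suc i                  ≡⟨ cong (_* p ^ suc i) e+f≡p ⟨
                 (e + f) * p ^ suc i            ≡⟨ *-distribʳ-+ (p ^ suc i) e f ⟩
                 e * p ^ suc i + f * p ^ suc i  ∎))
        = e * p ^ suc i + 0 , x * p ^ suc i + σ₀ ,
          ≤-trans (<⇒≤ y<eP) (m≤m+n _ _) ,
          subst (e * p ^ suc i + 0 <_) (sym (*-distribˡ-+ e (p ^ suc i) (ε (suc i))))
            (+-monoʳ-< (e * p ^ suc i) (*-mono-≤ 1≤e (≤-trans (m^n>0 p i) (m≤m+n (p ^ i) _)))) ,
          eq ,
          carryFree-digit (suc i) e x (subst (e + x <_) e+f≡p (+-monoʳ-< e x<f)) (carryFree-0ˡ (suc i) σ₀ σ₀<P)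

      not-multiple : ∀ P D k → D * P < k → k < suc D * P → ¬ P ∣ k
      not-multiple P D _ D<k k<D+1 (divides q refl) =
        <⇒≱ (*-cancelʳ-< P D q D<k) (≤-pred (*-cancelʳ-< P q (suc D) k<D+1))

      -- N + M is made equal to (D + 1 + Nh) p^j, so only multiples of p^j give binomial
      -- coefficients prime to p. For y = p^j - 1 - x the assumed carry says y < e `ε j`, as
      -- `double-split` requires. Since x = y + σ, the bound y ≤ z yields R ≤ v + s, and z < e `ε j`
      -- yields M + v + s ≤ 2R.
      exponents-block : ∀ j D x Nh → x < p ^ j → p ^ j ≤ x + e * ε j → Indivisible (suc D) Nh →
        Exponents (Nh * p ^ j + e * ε j) (D * p ^ j + x)
      exponents-block j D x Nh x<P P≤ p∤
        with y , x+y≡ ← m≤n⇒∃[o]m+o≡n x<P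
        with g , eε+g≡P ← m≤n⇒∃[o]m+o≡n (eε<p^j j)
        with z , σ , y≤z , z< , eq , cf ← double-split j y
               (+-cancelˡ-< x _ _ (≤-trans (≤-reflexive x+y≡) P≤))
        = record
        -- `suc g` is p^j - e `ε j`, the amount that completes the low digits of N to p^j.
        { M = D * P + suc g
        ; v = z
        ; s = D * P + σ
        ; t = suc D * P
        ; low-order = low
        ; p∤C[t] = subst₂ (λ n k → ¬ p ∣ n C k) (trans (lemma-E₀ (suc D) Nh P) (sym N+M≡)) (+-identityʳ (suc D * P))
            (carryFree-0ˡ j 0 (m^n>0 p j) (suc D) Nh p∤)
        ; p∤C[v] = cf 0 D p∤1
        ; s+t≡1+2R = lemma-st
        ; high-order = λ l t<l l≤ → subst (λ n → p ∣ n C l) (sym N+M≡)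
            (p∣C j (suc D + Nh) l (not-multiple P (suc D) l t<l
              (≤-<-trans l≤ (subst (_< suc (suc D) * P) (+-comm z (suc D * P)) (+-monoˡ-< (suc D * P) (<-trans z< (eε<p^j j)))))))
        ; M+v+s≤2R = lemma-M
        ; R≤v+s = lemma-R
        }
        where
        P = p ^ j
        N+M≡ : Nh * P + e * ε j + (D * P + suc g) ≡ (suc D + Nh) * P
        N+M≡ = trans (lemma Nh P (e * ε j) D g)
          (trans (cong (λ Q → (D + Nh) * P + Q) eε+g≡P) (lemma′ D Nh P))
          where
          lemma : ∀ N P E D g → N * P + E + (D * P + suc g) ≡ (D + N) * P + (suc E + g)
          lemma = solve-∀
          lemma′ : ∀ D N P → (D + N) * P + P ≡ (suc D + N) * P
          lemma′ = solve-∀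
        x≡ : x ≡ y + σ
        x≡ = +-cancelʳ-≡ y x (y + σ) (suc-injective (trans x+y≡ (trans (sym eq) (cong suc (lemma y σ)))))
          where
          lemma : ∀ y σ → y + y + σ ≡ y + σ + y
          lemma = solve-∀
        lemma-st : D * P + σ + suc D * P ≡ suc (D * P + x + (D * P + x))
        lemma-st = begin
          D * P + σ + (P + D * P)                      ≡⟨ cong (λ Q → D * P + σ + (Q + D * P)) eq ⟨
          D * P + σ + (suc (y + y + σ) + D * P)        ≡⟨ lemma (D * P) σ y ⟩
          suc (D * P + (y + σ) + (D * P + (y + σ)))    ≡⟨ cong (λ x → suc (D * P + x + (D * P + x))) x≡ ⟨
          suc (D * P + x + (D * P + x))                ∎
          where
          open ≡-Reasoning
          lemma : ∀ Q σ y → Q + σ + (suc (y + y + σ) + Q) ≡ suc (Q + (y + σ) + (Q + (y + σ)))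
          lemma = solve-∀
        lemma-M : D * P + suc g + (z + (D * P + σ)) ≤ D * P + x + (D * P + x)
        lemma-M = begin
          D * P + suc g + (z + (D * P + σ))        ≡⟨ lemma (D * P) g z σ ⟩
          D * P + (D * P + σ) + (suc z + g)        ≤⟨ +-monoʳ-≤ (D * P + (D * P + σ)) (+-monoˡ-≤ g z<) ⟩
          D * P + (D * P + σ) + (e * ε j + g)      ≡⟨ cong (D * P + (D * P + σ) +_) (suc-injective (trans eε+g≡P (sym eq))) ⟩
          D * P + (D * P + σ) + (y + y + σ)        ≡⟨ lemma′ (D * P) σ y ⟩
          D * P + (y + σ) + (D * P + (y + σ))      ≡⟨ cong (λ x → D * P + x + (D * P + x)) x≡ ⟨
          D * P + x + (D * P + x)                  ∎
          where
          open ≤-Reasoning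
          lemma : ∀ Q g z σ → Q + suc g + (z + (Q + σ)) ≡ Q + (Q + σ) + (suc z + g)
          lemma = solve-∀
          lemma′ : ∀ Q σ y → Q + (Q + σ) + (y + y + σ) ≡ Q + (y + σ) + (Q + (y + σ))
          lemma′ = solve-∀
        lemma-R : D * P + x ≤ z + (D * P + σ)
        lemma-R = begin
          D * P + x          ≡⟨ cong (D * P +_) x≡ ⟩
          D * P + (y + σ)    ≡⟨ lemma (D * P) y σ ⟩
          y + (D * P + σ)    ≤⟨ +-monoˡ-≤ _ y≤z ⟩
          z + (D * P + σ)    ∎
          where
          open ≤-Reasoning
          lemma : ∀ Q y σ → Q + (y + σ) ≡ y + (Q + σ)
          lemma = solve-∀
        lemma-E₀ : ∀ D N P → D * P + 0 + (N * P + 0) ≡ (D + N) * P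
        lemma-E₀ = solve-∀
        low : ∀ k → k < D * P + x → k < D * P + suc g ⊎ p ∣ ((Nh * P + e * ε j + (D * P + suc g)) C k)
        low k k<R with k <? D * P + suc g
        ... | yes k<M = inj₁ k<M
        ... | no  k≮M = inj₂ (subst (λ n → p ∣ n C k) (sym N+M≡)
                (p∣C j (suc D + Nh) k (not-multiple P D k
                  (<-≤-trans (m<m+n (D * P) (s≤s z≤n)) (≮⇒≥ k≮M))
                  (<-trans k<R (subst (D * P + x <_) (+-comm (D * P) P) (+-monoʳ-< (D * P) x<P))))))

      -- The plain choice M = r = R. With v = 0 no index l lies strictly between t and the next
      -- constraint, so only C(N + R, R + 1) has to be checked.
      exponents-digitwise : ∀ N R → ¬ p ∣ N → Indivisible R N → Exponents N R
      exponents-digitwise N R p∤N p∤ = record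
        { M = R ; v = 0 ; s = R ; t = suc R
        ; low-order = λ k k<R → inj₁ k<R
        ; p∤C[t] = λ p∣C → p∤* p∤N (subst (λ n → ¬ p ∣ n C R) (+-comm R N) p∤)
            (subst (p ∣_) (C-raise N R) (∣n⇒∣m*n (suc R) p∣C))
        ; p∤C[v] = p∤1
        ; s+t≡1+2R = +-suc R R
        ; high-order = λ l t<l l≤ → contradiction (subst (l ≤_) (+-identityʳ (suc R)) l≤) (<⇒≱ t<l)
        ; M+v+s≤2R = ≤-refl
        ; R≤v+s = ≤-refl
        }

      -- Descends through the digits of R = D p^j + x until the remaining part x is so large that
      -- adding N carries; rounding R up to (D + 1) p^j then gives the exponents.
      exponents-from : ∀ j D x Nh → x < p ^ j → ¬ p ∣ Nh * p ^ j + e * ε j → Indivisible D Nh →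
        Indivisible (suc D) Nh ⊎ x + e * ε j < p ^ j →
        Exponents (Nh * p ^ j + e * ε j) (D * p ^ j + x)
      exponents-from zero D zero Nh _ p∤N p∤ _ =
        exponents-digitwise _ _ p∤N (subst₂ Indivisible (lemma D) (lemma′ Nh e) p∤)
        where
        lemma : ∀ D → D ≡ D * 1 + 0
        lemma = solve-∀
        lemma′ : ∀ N e → N ≡ N * 1 + e * 0
        lemma′ = solve-∀
      exponents-from zero D (suc x) Nh (s≤s ()) _ _ _
      exponents-from (suc j) D x Nh x<P p∤N p∤ next with x + e * ε (suc j) <? p ^ suc j
      -- The low digits carry, so the alternative that excludes such a carry is gone; the other one
      -- says that D + 1 and Nh still add without carry, as rounding up requires.
      exponents-from (suc j) D x Nh x<P p∤N p∤ (inj₁ p∤₁) | no x+≮P =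
        exponents-block (suc j) D x Nh x<P (≮⇒≥ x+≮P) p∤₁
      exponents-from (suc j) D x Nh x<P p∤N p∤ (inj₂ x+<P) | no x+≮P = contradiction x+<P x+≮P
      exponents-from (suc j) D x Nh x<P p∤N p∤ next | yes x+<P
        with x₁ , x₀ , refl , x₀<P , x₁<p ← digit p j x x<P
        = subst₂ Exponents (sym N≡) (lemma D p x₁ (p ^ j) x₀)
            (exponents-from j (D * p + x₁) x₀ (Nh * p + e) x₀<P (subst (λ n → ¬ p ∣ n) N≡ p∤N)
              (lucas-step D Nh x₁ e x₁+e<p p∤) next′)
        where
        P = p ^ j
        lemma : ∀ D p x P y → (D * p + x) * P + y ≡ D * (p * P) + (x * P + y)
        lemma = solve-∀
        lemma-N : ∀ N p e P E → N * (p * P) + e * (P + E) ≡ (N * p + e) * P + e * E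
        lemma-N = solve-∀
        lemma-x : ∀ x P y e E → x * P + y + e * (P + E) ≡ (x + e) * P + (y + e * E)
        lemma-x = solve-∀
        N≡ = lemma-N Nh p e P (ε j)
        x+<P′ : (x₁ + e) * P + (x₀ + e * ε j) < p * P
        x+<P′ = subst (_< p * P) (lemma-x x₁ P x₀ e (ε j)) x+<P
        x₁+e<p : x₁ + e < p
        x₁+e<p = *-cancelʳ-< P _ _ (≤-<-trans (m≤m+n _ _) x+<P′)
        next′ : Indivisible (suc (D * p + x₁)) (Nh * p + e) ⊎ x₀ + e * ε j < P
        next′ with suc x₁ + e <? p
        ... | yes x₁+e+1<p = inj₁ (subst (λ n → Indivisible n (Nh * p + e)) (+-suc (D * p) x₁)
                                (lucas-step D Nh (suc x₁) e x₁+e+1<p p∤))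
        -- Here x₁ + e = p - 1, and the bound on x leaves no room for a carry from below.
        ... | no  x₁+e+1≮p = inj₂ (+-cancelˡ-< ((x₁ + e) * P) _ _
                (subst ((x₁ + e) * P + (x₀ + e * ε j) <_)
                  (trans (cong (_* P) (≤-antisym (≮⇒≥ x₁+e+1≮p) x₁+e<p)) (+-comm P ((x₁ + e) * P)))
                  x+<P′))

      exponents : ∀ k R → R < p ^ k → ¬ p ∣ e * ε k → Exponents (e * ε k) R
      exponents k R R<P p∤N = exponents-from k 0 R 0 R<P p∤N p∤1 (inj₁ p∤1)

-- Rearrangements valid in every commutative ring.

module RingIdentities {c ℓ} (K : CommutativeRing c ℓ) where

  open CommutativeRing K
  open import Algebra.Solver.Ring.NaturalCoefficients.Default commutativeSemiring

  bezout-expand : ∀ α u β v α′ β′ w → (α * u + β * v) * (α′ * u + β′ * w) ≈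
    (α * u * α′ + β * v * α′ + α * β′ * w) * u + β * β′ * (v * w)
  bezout-expand = solve 7 (λ α u β v α′ β′ w → (α :* u :+ β :* v) :* (α′ :* u :+ β′ :* w) :=
    (α :* u :* α′ :+ β :* v :* α′ :+ α :* β′ :* w) :* u :+ β :* β′ :* (v :* w)) refl

  bezout-combine : ∀ α u β v g h → α * u * (v * h) + β * v * (u * g) ≈ u * v * (α * h + β * g)
  bezout-combine = solve 6 (λ α u β v g h →
    α :* u :* (v :* h) :+ β :* v :* (u :* g) := u :* v :* (α :* h :+ β :* g)) refl

  low-step : ∀ γ β g h b φ → γ * (β * ((g + h * b) * φ)) ≈ g * (γ * (β * φ)) + h * (γ * ((b * β) * φ))
  low-step = solve 6 (λ γ β g h b φ → γ :* (β :* ((g :+ h :* b) :* φ)) :=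
    g :* (γ :* (β :* φ)) :+ h :* (γ :* ((b :* β) :* φ))) refl

  sub-add : ∀ x y → x ≈ y + (x + - y)
  sub-add x y = sym (trans (+-congˡ (+-comm x (- y))) (trans (sym (+-assoc y (- y) x))
    (trans (+-congʳ (-‿inverseʳ y)) (+-identityˡ x))))

  pull : ∀ γ u n y d t → γ * (u * (n * ((y * d) * t))) ≈ d * (γ * (u * (n * (y * t))))
  pull = solve 6 (λ γ u n y d t → γ :* (u :* (n :* ((y :* d) :* t))) := d :* (γ :* (u :* (n :* (y :* t))))) refl

  pull′ : ∀ γ d u z → γ * ((d * u) * z) ≈ d * (γ * (u * z))
  pull′ = solve 4 (λ γ d u z → γ :* ((d :* u) :* z) := d :* (γ :* (u :* z))) refl

  shift-linear : ∀ b x y λ′ → b * x + λ′ ≈ b * (x + - y) + (b * y + λ′)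
  shift-linear b x y λ′ = trans (+-congʳ (*-congˡ (sub-add x y)))
    (solve 4 (λ b y w l → b :* (y :+ w) :+ l := b :* w :+ (b :* y :+ l)) refl b y (x + - y) λ′)

  pascal-terms : ∀ v u P S x y → v * (P * (u * x * y)) + u * (S * (x * (v * y))) ≈ (S + P) * (u * x * (v * y))
  pascal-terms = solve 6 (λ v u P S x y →
    v :* (P :* (u :* x :* y)) :+ u :* (S :* (x :* (v :* y))) := (S :+ P) :* (u :* x :* (v :* y))) refl

  coef-term : ∀ c P g β Q β′ l → c * ((P * (g * β)) * (Q * (β′ * l))) ≈ ((P * Q) * (g * l)) * (c * (β * β′))
  coef-term = solve 7 (λ c P g β Q β′ l →
    c :* ((P :* (g :* β)) :* (Q :* (β′ :* l))) := ((P :* Q) :* (g :* l)) :* (c :* (β :* β′))) refl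

  moment-split : ∀ c d b x y → c * d * ((b + x) * y) ≈ b * (c * d * y) + c * (x * d * y)
  moment-split = solve 5 (λ c d b x y → c :* d :* ((b :+ x) :* y) := b :* (c :* d :* y) :+ c :* (x :* d :* y)) refl

-- The polynomial ring, by coefficient sequences.

module Polynomials {c ℓ} (K : CommutativeRing c ℓ) where

  open CommutativeRing K
  open import Algebra.Properties.CommutativeSemigroup +-commutativeSemigroup using (interchange)
  open import Algebra.Properties.Ring ring using (-0#≈0#)
  open import Relation.Binary.Reasoning.Setoid setoid

  -- Cauchy products in a form without subtraction: `w` receives both indices i and l with i + l =
  -- n.
  antidiagonal : (ℕ → ℕ → Carrier) → ℕ → Carrier
  antidiagonal w zero    = w 0 0
  antidiagonal w (suc n) = w 0 (suc n) + antidiagonal (w ∘ suc) n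

  antidiagonal-cong : ∀ {w w′} n → (∀ i l → i ℕ.+ l ≡ n → w i l ≈ w′ i l) →
                      antidiagonal w n ≈ antidiagonal w′ n
  antidiagonal-cong zero    eq = eq 0 0 ≡.refl
  antidiagonal-cong (suc n) eq =
    +-cong (eq 0 (suc n) ≡.refl) (antidiagonal-cong n λ i l i+l≡n → eq (suc i) l (≡.cong suc i+l≡n))

  antidiagonal-0 : ∀ n → antidiagonal (λ _ _ → 0#) n ≈ 0#
  antidiagonal-0 zero    = refl
  antidiagonal-0 (suc n) = trans (+-identityˡ _) (antidiagonal-0 n)

  antidiagonal-+ : ∀ w w′ n → antidiagonal (λ i l → w i l + w′ i l) n ≈ antidiagonal w n + antidiagonal w′ n
  antidiagonal-+ w w′ zero    = refl
  antidiagonal-+ w w′ (suc n) =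
    trans (+-congˡ (antidiagonal-+ (w ∘ suc) (w′ ∘ suc) n)) (interchange _ _ _ _)

  antidiagonal-* : ∀ x w n → antidiagonal (λ i l → x * w i l) n ≈ x * antidiagonal w n
  antidiagonal-* x w zero    = refl
  antidiagonal-* x w (suc n) = trans (+-congˡ (antidiagonal-* x (w ∘ suc) n)) (sym (distribˡ x _ _))

  antidiagonal-last : ∀ w n → antidiagonal w (suc n) ≈ antidiagonal (λ i l → w i (suc l)) n + w (suc n) 0
  antidiagonal-last w zero    = refl
  antidiagonal-last w (suc n) = trans (+-congˡ (antidiagonal-last (w ∘ suc) n)) (sym (+-assoc _ _ _))

  antidiagonal-flip : ∀ w n → antidiagonal w n ≈ antidiagonal (λ i l → w l i) n
  antidiagonal-flip w zero    = refl
  antidiagonal-flip w (suc n) = begin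
    w 0 (suc n) + antidiagonal (w ∘ suc) n                ≈⟨ +-comm _ _ ⟩
    antidiagonal (w ∘ suc) n + w 0 (suc n)                ≈⟨ +-congʳ (antidiagonal-flip (w ∘ suc) n) ⟩
    antidiagonal (λ i l → w (suc l) i) n + w 0 (suc n)    ≈⟨ antidiagonal-last (λ i l → w l i) n ⟨
    antidiagonal (λ i l → w l i) (suc n)                  ∎

  -- Both sides sum over j + k + l = n; this is associativity of the product of polynomials.
  antidiagonal-assoc : ∀ (w : ℕ → ℕ → ℕ → Carrier) n →
    antidiagonal (λ i l → antidiagonal (λ j k → w j k l) i) n ≈
    antidiagonal (λ j i → antidiagonal (λ k l → w j k l) i) n
  antidiagonal-assoc w zero    = refl
  antidiagonal-assoc w (suc n) = begin
    w 0 0 (suc n) + antidiagonal (λ i l → w 0 (suc i) l + antidiagonal (λ j k → w (suc j) k l) i) n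
      ≈⟨ +-congˡ (antidiagonal-+ _ _ n) ⟩
    w 0 0 (suc n) + (antidiagonal (λ i l → w 0 (suc i) l) n + antidiagonal (λ i l → antidiagonal (λ j k → w (suc j) k l) i) n)
      ≈⟨ +-assoc _ _ _ ⟨
    antidiagonal (w 0) (suc n) + antidiagonal (λ i l → antidiagonal (λ j k → w (suc j) k l) i) n
      ≈⟨ +-congˡ (antidiagonal-assoc (w ∘ suc) n) ⟩
    antidiagonal (λ j i → antidiagonal (λ k l → w j k l) i) (suc n) ∎

  antidiagonal-single : ∀ w i₀ l₀ → (∀ i l → i ℕ.+ l ≡ i₀ ℕ.+ l₀ → ¬ l ≡ l₀ → w i l ≈ 0#) →
                        antidiagonal w (i₀ ℕ.+ l₀) ≈ w i₀ l₀
  antidiagonal-single w zero     zero     w≈0 = refl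
  antidiagonal-single w zero     (suc l₀) w≈0 = begin
    w 0 (suc l₀) + antidiagonal (w ∘ suc) l₀           ≈⟨ +-congˡ (antidiagonal-cong l₀ λ i l i+l≡ →
                                                             w≈0 (suc i) l (≡.cong suc i+l≡)
                                                               (ℕ.<⇒≢ (s≤s (≡.subst (l ≤_) i+l≡ (ℕ.m≤n+m l i))))) ⟩
    w 0 (suc l₀) + antidiagonal (λ _ _ → 0#) l₀        ≈⟨ +-congˡ (antidiagonal-0 l₀) ⟩
    w 0 (suc l₀) + 0#                                  ≈⟨ +-identityʳ _ ⟩
    w 0 (suc l₀)                                       ∎
  antidiagonal-single w (suc i₀) l₀ w≈0 = begin
    w 0 (suc (i₀ ℕ.+ l₀)) + antidiagonal (w ∘ suc) (i₀ ℕ.+ l₀)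
      ≈⟨ +-cong (w≈0 0 _ ≡.refl (ℕ.<⇒≢ (s≤s (ℕ.m≤n+m l₀ i₀)) ∘ ≡.sym))
                (antidiagonal-single (w ∘ suc) i₀ l₀ λ i l i+l≡ → w≈0 (suc i) l (≡.cong suc i+l≡)) ⟩
    0# + w (suc i₀) l₀
      ≈⟨ +-identityˡ _ ⟩
    w (suc i₀) l₀ ∎

  -- `bound` is any upper bound for the degree. It separates polynomials from power series, among
  -- which X - a is invertible for a ≠ 0 and roots would bound nothing.
  record Poly : Set (c ⊔ ℓ) where
    no-eta-equality
    field
      coef   : ℕ → Carrier
      bound  : ℕ
      vanish : ∀ i → bound < i → coef i ≈ 0#
  open Poly public

  infix 4 _≋_
  record _≋_ (f g : Poly) : Set ℓ where
    no-eta-equality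
    constructor coefs
    field coef≈ : ∀ i → coef f i ≈ coef g i
  open _≋_ public

  DegreeBelow : ℕ → Poly → Set ℓ
  DegreeBelow n f = ∀ i → n ≤ i → coef f i ≈ 0#

  abstract

    _⊕_ _⊛_ : Poly → Poly → Poly
    f ⊕ g = record
      { coef   = λ i → coef f i + coef g i
      ; bound  = bound f ℕ.⊔ bound g
      ; vanish = λ i b<i → trans
          (+-cong (vanish f i (ℕ.≤-<-trans (ℕ.m≤m⊔n _ _) b<i)) (vanish g i (ℕ.≤-<-trans (ℕ.m≤n⊔m (bound f) _) b<i)))
          (+-identityˡ 0#)
      }
    f ⊛ g = record
      { coef   = antidiagonal λ i l → coef f i * coef g l
      ; bound  = bound f ℕ.+ bound g
      ; vanish = λ n b<n → trans (antidiagonal-cong n (term≈0 n b<n)) (antidiagonal-0 n)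
      }
      where
      term≈0 : ∀ n → bound f ℕ.+ bound g < n → ∀ i l → i ℕ.+ l ≡ n → coef f i * coef g l ≈ 0#
      term≈0 n b<n i l i+l≡n with bound f ℕ.<? i
      ... | yes b<i = trans (*-congʳ (vanish f i b<i)) (zeroˡ _)
      ... | no  b≮i with bound g ℕ.<? l
      ...   | yes b<l = trans (*-congˡ (vanish g l b<l)) (zeroʳ _)
      ...   | no  b≮l = contradiction (≡.subst (_ <_) (≡.sym i+l≡n) b<n) (ℕ.≤⇒≯ (ℕ.+-mono-≤ (ℕ.≮⇒≥ b≮i) (ℕ.≮⇒≥ b≮l)))

    -- linear u v is u X + v
    linear : Carrier → Carrier → Poly
    linear u v = record { coef = a ; bound = 1 ; vanish = a≈0 }
      where
      a : ℕ → Carrier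
      a 0             = v
      a 1             = u
      a (suc (suc _)) = 0#
      a≈0 : ∀ i → 1 < i → a i ≈ 0#
      a≈0 (suc (suc i)) _ = refl
      a≈0 (suc zero) (s≤s ())

    constant : Carrier → Poly
    constant v = record { coef = a ; bound = 0 ; vanish = a≈0 }
      where
      a : ℕ → Carrier
      a zero    = v
      a (suc _) = 0#
      a≈0 : ∀ i → 0 < i → a i ≈ 0#
      a≈0 (suc i) _ = refl

    ⊖_ : Poly → Poly
    ⊖ f = record
      { coef   = λ i → - coef f i
      ; bound  = bound f
      ; vanish = λ i b<i → trans (-‿cong (vanish f i b<i)) -0#≈0#
      }

    coef-constant-* : ∀ x f i → coef (constant x ⊛ f) i ≈ x * coef f i
    coef-constant-* x f zero    = refl
    coef-constant-* x f (suc i) = trans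
      (+-congˡ (trans (antidiagonal-cong i λ _ _ _ → zeroˡ _) (antidiagonal-0 i))) (+-identityʳ _)

    coef-linear-* : ∀ u v f i → coef (linear u v ⊛ f) (suc i) ≈ v * coef f (suc i) + u * coef f i
    coef-linear-* u v f zero    = refl
    coef-linear-* u v f (suc i) = +-congˡ (trans
      (+-congˡ (trans (antidiagonal-cong i λ _ _ _ → zeroˡ _) (antidiagonal-0 i))) (+-identityʳ _))

    coef-⊕ : ∀ f g i → coef (f ⊕ g) i ≈ coef f i + coef g i
    coef-⊕ f g i = refl

    coef-⊛ : ∀ f g n → coef (f ⊛ g) n ≈ antidiagonal (λ i l → coef f i * coef g l) n
    coef-⊛ f g n = refl

    coef-constant-0 : ∀ x → coef (constant x) 0 ≈ x
    coef-constant-0 x = refl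

    coef-constant-suc : ∀ x i → coef (constant x) (suc i) ≈ 0#
    coef-constant-suc x i = refl

    coef-linear-*-0 : ∀ u v f → coef (linear u v ⊛ f) 0 ≈ v * coef f 0
    coef-linear-*-0 u v f = refl

    constant-cong : ∀ {x y} → x ≈ y → constant x ≋ constant y
    constant-cong x≈y = coefs λ { zero → x≈y ; (suc i) → refl }

    constant-+ : ∀ x y → constant x ⊕ constant y ≋ constant (x + y)
    constant-+ x y = coefs λ { zero → refl ; (suc i) → +-identityˡ 0# }

    constant-* : ∀ x y → constant x ⊛ constant y ≋ constant (x * y)
    constant-* x y = coefs λ i → trans (coef-constant-* x (constant y) i) (at i)
      where
      at : ∀ i → x * coef (constant y) i ≈ coef (constant (x * y)) i
      at zero    = refl
      at (suc i) = zeroʳ x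

    X-constant : ∀ x → linear 1# 0# ⊕ (⊖ constant x) ≋ linear 1# (- x)
    X-constant x = coefs λ { 0 → +-identityˡ _ ; 1 → trans (+-congˡ -0#≈0#) (+-identityʳ 1#)
                           ; (suc (suc i)) → trans (+-congˡ -0#≈0#) (+-identityʳ 0#) }

    constant-*-X : ∀ x y → (constant x ⊛ linear 1# 0#) ⊕ constant y ≋ linear x y
    constant-*-X x y = coefs λ i → trans (+-congʳ (coef-constant-* x (linear 1# 0#) i)) (at i)
      where
      at : ∀ i → x * coef (linear 1# 0#) i + coef (constant y) i ≈ coef (linear x y) i
      at 0             = trans (+-congʳ (zeroʳ _)) (+-identityˡ y)
      at 1             = trans (+-identityʳ _) (*-identityʳ _)
      at (suc (suc i)) = trans (+-identityʳ _) (zeroʳ _)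

    linear-combination : ∀ x u v y u′ v′ →
      (constant x ⊛ linear u v) ⊕ (constant y ⊛ linear u′ v′) ≋ linear (x * u + y * u′) (x * v + y * v′)
    linear-combination x u v y u′ v′ = coefs λ i → trans
      (+-cong (coef-constant-* x (linear u v) i) (coef-constant-* y (linear u′ v′) i)) (at i)
      where
      at : ∀ i → x * coef (linear u v) i + y * coef (linear u′ v′) i ≈ coef (linear (x * u + y * u′) (x * v + y * v′)) i
      at 0             = refl
      at 1             = refl
      at (suc (suc i)) = trans (+-cong (zeroʳ _) (zeroʳ _)) (+-identityˡ 0#)

    linear-constant : ∀ {u v x} → u ≈ 0# → v ≈ x → linear u v ≋ constant x
    linear-constant u≈0 v≈x = coefs λ { 0 → v≈x ; 1 → u≈0 ; (suc (suc i)) → refl }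

    polynomial-isCommutativeRing : IsCommutativeRing _≋_ _⊕_ _⊛_ ⊖_ (constant 0#) (constant 1#)
    polynomial-isCommutativeRing = record
      { isRing = record
        { +-isAbelianGroup = record
          { isGroup = record
            { isMonoid = record
              { isSemigroup = record
                { isMagma = record
                  { isEquivalence = record
                    { refl  = coefs λ i → refl
                    ; sym   = λ p → coefs λ i → sym (coef≈ p i)
                    ; trans = λ p q → coefs λ i → trans (coef≈ p i) (coef≈ q i)
                    }
                  ; ∙-cong = λ p q → coefs λ i → +-cong (coef≈ p i) (coef≈ q i)
                  }
                ; assoc = λ f g h → coefs λ i → +-assoc _ _ _
                }
              ; identity = (λ f → coefs λ i → trans (+-congʳ (coef-0 i)) (+-identityˡ _))
                         , (λ f → coefs λ i → trans (+-congˡ (coef-0 i)) (+-identityʳ _))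
              }
            ; inverse = (λ f → coefs λ i → trans (-‿inverseˡ _) (sym (coef-0 i)))
                      , (λ f → coefs λ i → trans (-‿inverseʳ _) (sym (coef-0 i)))
            ; ⁻¹-cong = λ p → coefs λ i → -‿cong (coef≈ p i)
            }
          ; comm = λ f g → coefs λ i → +-comm _ _
          }
        ; *-cong = λ p q → coefs λ n → antidiagonal-cong n λ i l _ → *-cong (coef≈ p i) (coef≈ q l)
        ; *-assoc = ⊛-assoc
        ; *-identity = (λ f → coefs λ i → trans (coef-constant-* 1# f i) (*-identityˡ _))
                     , (λ f → coefs λ i → trans (coef≈ (⊛-comm f (constant 1#)) i)
                                                 (trans (coef-constant-* 1# f i) (*-identityˡ _)))
        ; distrib = (λ f g h → coefs λ n → trans (antidiagonal-cong n λ i l _ → distribˡ _ _ _) (antidiagonal-+ _ _ n))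
                  , (λ f g h → coefs λ n → trans (antidiagonal-cong n λ i l _ → distribʳ _ _ _) (antidiagonal-+ _ _ n))
        }
      ; *-comm = ⊛-comm
      }
      where
      coef-0 : ∀ i → coef (constant 0#) i ≈ 0#
      coef-0 zero    = refl
      coef-0 (suc i) = refl
      ⊛-comm : ∀ f g → f ⊛ g ≋ g ⊛ f
      ⊛-comm f g = coefs λ n → trans (antidiagonal-flip _ n) (antidiagonal-cong n λ i l _ → *-comm _ _)
      ⊛-assoc : ∀ f g h → (f ⊛ g) ⊛ h ≋ f ⊛ (g ⊛ h)
      ⊛-assoc f g h = coefs λ n → begin
        antidiagonal (λ i l → antidiagonal (λ j k → coef f j * coef g k) i * coef h l) n
          ≈⟨ antidiagonal-cong n (λ i l _ → trans (*-comm _ _) (trans (sym (antidiagonal-* _ _ i))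
               (antidiagonal-cong i λ j k _ → trans (*-comm _ _) (*-assoc _ _ _)))) ⟩
        antidiagonal (λ i l → antidiagonal (λ j k → coef f j * (coef g k * coef h l)) i) n
          ≈⟨ antidiagonal-assoc (λ j k l → coef f j * (coef g k * coef h l)) n ⟩
        antidiagonal (λ j i → antidiagonal (λ k l → coef f j * (coef g k * coef h l)) i) n
          ≈⟨ antidiagonal-cong n (λ j i _ → antidiagonal-* _ _ i) ⟩
        antidiagonal (λ j i → coef f j * antidiagonal (λ k l → coef g k * coef h l) i) n ∎

  polynomialRing : CommutativeRing (c ⊔ ℓ) ℓ
  polynomialRing = record { isCommutativeRing = polynomial-isCommutativeRing }

-- Divisibility, and the order of vanishing of f, in a commutative ring.

module Divisibility {c ℓ} (Q : CommutativeRing c ℓ) where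

  open CommutativeRing Q hiding (zero)
  open RingIdentities Q
  open import Algebra.Properties.Ring ring using (-‿distribʳ-*; -1*x≈-x)
  open import Algebra.Properties.Semiring.Sum semiring
  open import Algebra.Properties.Semiring.Mult semiring renaming (_×_ to _·_)
  open import Algebra.Properties.Semiring.Exp semiring
  open import Algebra.Properties.CommutativeSemiring.Exp commutativeSemiring using (^-distrib-*)
  open import Algebra.Properties.CommutativeSemiring.Binomial commutativeSemiring using () renaming (theorem to binomial-theorem)
  open import Relation.Binary.Reasoning.Setoid setoid

  infix 4 _∣_
  _∣_ : Carrier → Carrier → Set (c ⊔ ℓ)
  d ∣ x = ∃ λ g → x ≈ d * g

  ∣-resp : ∀ {d x y} → x ≈ y → d ∣ x → d ∣ y
  ∣-resp x≈y (g , x≈) = g , trans (sym x≈y) x≈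

  ∣-0 : ∀ {d} → d ∣ 0#
  ∣-0 = 0# , sym (zeroʳ _)

  ∣-+ : ∀ {d x y} → d ∣ x → d ∣ y → d ∣ x + y
  ∣-+ (g , x≈) (h , y≈) = g + h , trans (+-cong x≈ y≈) (sym (distribˡ _ g h))

  ∣-neg : ∀ {d x} → d ∣ x → d ∣ - x
  ∣-neg (g , x≈) = - g , trans (-‿cong x≈) (-‿distribʳ-* _ g)

  ∣-sum : ∀ {n d} (t : Fin n → Carrier) → (∀ i → d ∣ t i) → d ∣ sum t
  ∣-sum {zero}  t d∣ = ∣-0
  ∣-sum {suc n} t d∣ = ∣-+ (d∣ zero) (∣-sum (t ∘ suc) (d∣ ∘ suc))

  sum-≈0 : ∀ {n} (t : Fin n → Carrier) → (∀ i → t i ≈ 0#) → sum t ≈ 0#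
  sum-≈0 {n} t t≈0 = trans (sum-cong-≋ t≈0) (sum-replicate-zero n)

  ×≈×1* : ∀ n x → n · x ≈ (n · 1#) * x
  ×≈×1* n x = trans (×-congʳ n (sym (*-identityˡ x))) (sym (×-assoc-* n 1# x))

  -- Comaximality, because a Bézout identity passes to products and powers in any commutative ring,
  -- without division with remainder.
  Coprime : Carrier → Carrier → Set (c ⊔ ℓ)
  Coprime u v = ∃₂ λ α β → α * u + β * v ≈ 1#

  coprime-sym : ∀ {u v} → Coprime u v → Coprime v u
  coprime-sym (α , β , eq) = β , α , trans (+-comm _ _) eq

  coprime-1 : ∀ {u} → Coprime u 1#
  coprime-1 = 0# , 1# , trans (+-cong (zeroˡ _) (*-identityˡ 1#)) (+-identityˡ 1#)

  coprime-* : ∀ {u v w} → Coprime u v → Coprime u w → Coprime u (v * w)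
  coprime-* (α , β , eq) (α′ , β′ , eq′) = _ , _ ,
    trans (sym (bezout-expand α _ β _ α′ β′ _)) (trans (*-cong eq eq′) (*-identityˡ 1#))

  coprime-^ : ∀ {u v} n → Coprime u v → Coprime u (v ^ n)
  coprime-^ zero    _ = coprime-1
  coprime-^ (suc n) c = coprime-* c (coprime-^ n c)

  coprime-∣-* : ∀ {u v x} → Coprime u v → u ∣ x → v ∣ x → u * v ∣ x
  coprime-∣-* {u} {v} {x} (α , β , eq) (g , x≈ug) (h , x≈vh) = α * h + β * g , (begin
    x                                    ≈⟨ *-identityˡ x ⟨
    1# * x                               ≈⟨ *-congʳ eq ⟨
    (α * u + β * v) * x                  ≈⟨ distribʳ x _ _ ⟩
    α * u * x + β * v * x                ≈⟨ +-cong (*-congˡ x≈vh) (*-congˡ x≈ug) ⟩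
    α * u * (v * h) + β * v * (u * g)    ≈⟨ bezout-combine α u β v g h ⟩
    u * v * (α * h + β * g)              ∎)

  ∏ : ∀ {m} → (Fin m → Carrier) → Carrier
  ∏ = Vector.foldr _*_ 1#

  coprime-∏ : ∀ {m u} (h : Fin m → Carrier) → (∀ i → Coprime u (h i)) → Coprime u (∏ h)
  coprime-∏ {zero}  h c = coprime-1
  coprime-∏ {suc m} h c = coprime-* (c zero) (coprime-∏ (h ∘ suc) (c ∘ suc))

  coprime-∏-∣ : ∀ {m x} (h : Fin m → Carrier) → (∀ i j → ¬ i ≡ j → Coprime (h i) (h j)) →
                (∀ i → h i ∣ x) → ∏ h ∣ x
  coprime-∏-∣ {zero}  {x} h c h∣x = x , sym (*-identityˡ x)
  coprime-∏-∣ {suc m} h c h∣x = coprime-∣-* (coprime-∏ (h ∘ suc) λ j → c zero (suc j) λ ())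
    (h∣x zero) (coprime-∏-∣ (h ∘ suc) (λ i j i≢j → c (suc i) (suc j) (i≢j ∘ Fin.suc-injective)) (h∣x ∘ suc))

  module Moments {n} (γ B : Fin n → Carrier) (L : ℕ)
                 (moment≈0 : ∀ j → j ≤ L → ∑[ i < n ] (γ i * B i ^ j) ≈ 0#) where

    -- Satisfied when φ i is a polynomial in B i of degree at most l.
    Low : ℕ → (Fin n → Carrier) → Set ℓ
    Low l φ = ∀ j → j ℕ.+ l ≤ L → ∑[ i < n ] (γ i * (B i ^ j * φ i)) ≈ 0#

    low-constant : ∀ x → Low 0 (λ _ → x)
    low-constant x j j≤L = begin
      ∑[ i < n ] (γ i * (B i ^ j * x)) ≈⟨ sum-cong-≋ (λ i → *-assoc (γ i) _ x) ⟨
      ∑[ i < n ] (γ i * B i ^ j * x)   ≈⟨ *-distribʳ-sum x (λ i → γ i * B i ^ j) ⟨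
      (∑[ i < n ] (γ i * B i ^ j)) * x ≈⟨ *-congʳ (moment≈0 j (≡.subst (_≤ L) (ℕ.+-identityʳ j) j≤L)) ⟩
      0# * x                           ≈⟨ zeroˡ x ⟩
      0#                               ∎

    low-linear : ∀ {l φ} g h → Low l φ → Low (suc l) (λ i → (g + h * B i) * φ i)
    low-linear {l} {φ} g h low j j≤L = begin
      ∑[ i < n ] (γ i * (B i ^ j * ((g + h * B i) * φ i)))
        ≈⟨ sum-cong-≋ (λ i → low-step (γ i) (B i ^ j) g h (B i) (φ i)) ⟩
      ∑[ i < n ] (g * (γ i * (B i ^ j * φ i)) + h * (γ i * (B i ^ suc j * φ i)))
        ≈⟨ ∑-distrib-+ (λ i → g * (γ i * (B i ^ j * φ i))) (λ i → h * (γ i * (B i ^ suc j * φ i))) ⟩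
      ∑[ i < n ] (g * (γ i * (B i ^ j * φ i))) + ∑[ i < n ] (h * (γ i * (B i ^ suc j * φ i)))
        ≈⟨ +-cong (*-distribˡ-sum g (λ i → γ i * (B i ^ j * φ i))) (*-distribˡ-sum h (λ i → γ i * (B i ^ suc j * φ i))) ⟨
      g * ∑[ i < n ] (γ i * (B i ^ j * φ i)) + h * ∑[ i < n ] (γ i * (B i ^ suc j * φ i))
        ≈⟨ +-cong (*-congˡ (low j (ℕ.≤-trans (ℕ.+-monoʳ-≤ j (ℕ.n≤1+n l)) j≤L)))
                  (*-congˡ (low (suc j) (≡.subst (_≤ L) (ℕ.+-suc j l) j≤L))) ⟩
      g * 0# + h * 0#
        ≈⟨ trans (+-cong (zeroʳ g) (zeroʳ h)) (+-identityˡ 0#) ⟩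
      0# ∎

    low-resp : ∀ {l φ ψ} → (∀ i → φ i ≈ ψ i) → Low l φ → Low l ψ
    low-resp φ≈ψ low j j≤L = trans (sum-cong-≋ (λ i → *-congˡ (*-congˡ (sym (φ≈ψ i))))) (low j j≤L)

    low-power : ∀ {l φ} m g h → Low l φ → Low (m ℕ.+ l) (λ i → (g + h * B i) ^ m * φ i)
    low-power zero    g h low = low-resp (λ i → sym (*-identityˡ _)) low
    low-power (suc m) g h low = low-resp (λ i → sym (*-assoc _ _ _)) (low-linear g h (low-power m g h low))

    module _ (X lam : Carrier) where

      -- The f of the overview, with X any ring element and E in place of N + M.
      combination : ℕ → ℕ → Carrier
      combination r E = ∑[ i < n ] (γ i * ((X + - B i) ^ r * (B i * X + lam) ^ E))

      module _ (i₀ : Fin n) (R r N M : ℕ) (R≤r : R ≤ r) (M+r≤L : M ℕ.+ r ≤ L)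
               (fixed : ∀ i → ¬ i ≡ i₀ → (B i * B i₀ + lam) ^ suc N ≈ B i * B i₀ + lam)
               (low-order : ∀ k → k < R → k < M ⊎ ((N ℕ.+ M) C k) · 1# ≈ 0#) where

        private
          E = N ℕ.+ M
          H = X + - B i₀
          τ : Fin n → Carrier
          τ i = B i * B i₀ + lam

          expansion : Fin n → Fin (suc E) → Carrier
          expansion i k = (E C toℕ k) · ((B i * H) ^ toℕ k * τ i ^ (E ∸ toℕ k))

          -- Order k of summand i in the expansion around `B i₀`. The exponent w of `τ i` is left
          -- free so that E - k can be exchanged for M - k.
          term : ℕ → ℕ → Fin n → Carrier
          term k w i = γ i * ((X + - B i) ^ r * ((E C k) · ((B i * H) ^ k * τ i ^ w)))

          term-high : ∀ k w i → R ≤ k → H ^ R ∣ term k w i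
          term-high k w i R≤k with d , ≡.refl ← ℕ.m≤n⇒∃[o]m+o≡n R≤k = _ , (begin
            γ i * (U * ((E C k) · ((B i * H) ^ k * τ i ^ w)))
              ≈⟨ *-congˡ (*-congˡ (trans (×≈×1* (E C k) _) (*-congˡ (*-congʳ
                   (trans (^-homo-* (B i * H) R d) (trans (*-congʳ (^-distrib-* (B i) H R))
                     (trans (*-assoc _ _ _) (trans (*-congˡ (*-comm _ _)) (sym (*-assoc _ _ _)))))))))) ⟩
            γ i * (U * (((E C k) · 1#) * (((B i ^ R * (B i * H) ^ d) * H ^ R) * τ i ^ w)))
              ≈⟨ pull (γ i) U ((E C k) · 1#) (B i ^ R * (B i * H) ^ d) (H ^ R) (τ i ^ w) ⟩
            H ^ R * _ ∎)
            where U = (X + - B i) ^ r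

          term-i₀ : ∀ k w → H ^ R ∣ term k w i₀
          term-i₀ k w with d , ≡.refl ← ℕ.m≤n⇒∃[o]m+o≡n R≤r = _ , (begin
            γ i₀ * (H ^ (R ℕ.+ d) * z)       ≈⟨ *-congˡ (*-congʳ (^-homo-* H R d)) ⟩
            γ i₀ * ((H ^ R * H ^ d) * z)     ≈⟨ pull′ (γ i₀) (H ^ R) (H ^ d) z ⟩
            H ^ R * (γ i₀ * (H ^ d * z))     ∎)
            where z = (E C k) · ((B i₀ * H) ^ k * τ i₀ ^ w)

          -- The identity τ^(N + 1) = τ removes N from the exponent N + (M - k) as long as one
          -- factor τ is left over, hence k < M.
          term-reduce : ∀ k → k < M → ∀ i → ¬ i ≡ i₀ → term k (E ∸ k) i ≈ term k (M ∸ k) i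
          term-reduce k k<M i i≢i₀ = *-congˡ (*-congˡ (×-congʳ (E C k) (*-congˡ power)))
            where
            power : τ i ^ (E ∸ k) ≈ τ i ^ (M ∸ k)
            power with w , ≡.refl ← ℕ.m≤n⇒∃[o]m+o≡n k<M = begin
              τ i ^ (N ℕ.+ (suc k ℕ.+ w) ∸ k)  ≈⟨ ^-congʳ (τ i) (≡.trans (ℕ.+-∸-assoc N (ℕ.<⇒≤ k<M)) (≡.cong (N ℕ.+_) eq)) ⟩
              τ i ^ (N ℕ.+ suc w)              ≈⟨ ^-congʳ (τ i) (ℕ.+-suc N w) ⟩
              τ i ^ (suc N ℕ.+ w)              ≈⟨ ^-homo-* (τ i) (suc N) w ⟩
              τ i ^ suc N * τ i ^ w            ≈⟨ *-congʳ (fixed i i≢i₀) ⟩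
              τ i ^ suc w                      ≈⟨ ^-congʳ (τ i) eq ⟨
              τ i ^ (suc k ℕ.+ w ∸ k)          ∎
              where
              eq : suc k ℕ.+ w ∸ k ≡ suc w
              eq = ≡.trans (≡.cong (_∸ k) (≡.sym (ℕ.+-suc k w))) (ℕ.m+n∸m≡n k (suc w))

          -- Summand i is γ i times a product of r + k + (M - k) factors linear in `B i`, with
          -- coefficients independent of i. Its degree M + r is within the range of vanishing
          -- moments.
          sum-term-low : ∀ k → k < M → ∑[ i < n ] term k (M ∸ k) i ≈ 0#
          sum-term-low k k<M = trans
            (sum-cong-≋ λ i → *-congˡ (begin
              (X + - B i) ^ r * ((E C k) · ((B i * H) ^ k * τ i ^ (M ∸ k)))
                ≈⟨ *-cong (^-congˡ r (+-congˡ (-1*x≈-x (B i)))) (trans (*-cong (^-congˡ k (trans (+-identityˡ _) (*-comm H (B i)))) (*-congʳ (^-congˡ (M ∸ k) (trans (+-comm _ _) (+-congʳ (*-comm (B i₀) (B i))))))) (trans (sym (*-assoc _ _ _)) (trans (*-comm _ _) (sym (×≈×1* (E C k) _))))) ⟨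
              ψ i
                ≈⟨ *-identityˡ (ψ i) ⟨
              1# * ψ i ∎))
            (low-power r X (- 1#) (low-power k 0# H (low-power (M ∸ k) lam (B i₀) (low-constant ((E C k) · 1#)))) 0 degree)
            where
            ψ : Fin n → Carrier
            ψ i = (X + - 1# * B i) ^ r * ((0# + H * B i) ^ k * ((lam + B i₀ * B i) ^ (M ∸ k) * ((E C k) · 1#)))
            degree : r ℕ.+ (k ℕ.+ (M ∸ k ℕ.+ 0)) ≤ L
            degree = ℕ.≤-trans (ℕ.≤-reflexive (≡.trans
              (≡.cong (r ℕ.+_) (≡.trans (≡.cong (k ℕ.+_) (ℕ.+-identityʳ _)) (ℕ.m+[n∸m]≡n (ℕ.<⇒≤ k<M)))) (ℕ.+-comm r M))) M+r≤L

          ∣-sum-term : ∀ k → H ^ R ∣ ∑[ i < n ] term k (E ∸ k) i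
          ∣-sum-term k with k ℕ.<? R
          ... | no  k≮R = ∣-sum (term k (E ∸ k)) λ i → term-high k (E ∸ k) i (ℕ.≮⇒≥ k≮R)
          ... | yes k<R with low-order k k<R
          ...   | inj₂ C≈0 = ∣-resp (sym (sum-≈0 (term k (E ∸ k)) λ i →
                    trans (*-congˡ (trans (*-congˡ (trans (×≈×1* (E C k) _) (trans (*-congʳ C≈0) (zeroˡ _)))) (zeroʳ _))) (zeroʳ _))) ∣-0
          -- Subtract the vanishing sum with exponent M - k. The differences are zero for i ≠ i₀; at
          -- i₀ the factor H^r, with r ≥ R, supplies the divisibility.
          ...   | inj₁ k<M = ∣-resp (sym (begin
                    ∑[ i < n ] t i                            ≈⟨ sum-cong-≋ (λ i → sub-add (t i) (t′ i)) ⟩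
                    ∑[ i < n ] (t′ i + (t i + - t′ i))        ≈⟨ ∑-distrib-+ t′ (λ i → t i + - t′ i) ⟩
                    sum t′ + ∑[ i < n ] (t i + - t′ i)        ≈⟨ +-congʳ (sum-term-low k k<M) ⟩
                    0# + ∑[ i < n ] (t i + - t′ i)            ≈⟨ +-identityˡ _ ⟩
                    ∑[ i < n ] (t i + - t′ i)                 ∎))
                  (∣-sum (λ i → t i + - t′ i) difference)
            where
            t  = term k (E ∸ k)
            t′ = term k (M ∸ k)
            difference : ∀ i → H ^ R ∣ t i + - t′ i
            difference i with i Fin.≟ i₀
            ... | yes ≡.refl = ∣-+ (term-i₀ k (E ∸ k)) (∣-neg (term-i₀ k (M ∸ k)))
            ... | no  i≢i₀   = ∣-resp (sym (trans (+-congʳ (term-reduce k k<M i i≢i₀)) (-‿inverseʳ _))) ∣-0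

        ∣-combination : H ^ R ∣ combination r E
        ∣-combination = ∣-resp (sym (begin
          combination r E
            ≈⟨ sum-cong-≋ (λ i → *-congˡ (trans (*-congˡ (trans (^-congˡ E (shift-linear (B i) X (B i₀) lam))
                 (binomial-theorem E (B i * H) (τ i)))) (*-distribˡ-sum _ (expansion i)))) ⟩
          ∑[ i < n ] (γ i * ∑[ k < suc E ] ((X + - B i) ^ r * expansion i k))
            ≈⟨ sum-cong-≋ (λ i → *-distribˡ-sum (γ i) (λ k → (X + - B i) ^ r * expansion i k)) ⟩
          ∑[ i < n ] ∑[ k < suc E ] term (toℕ k) (E ∸ toℕ k) i
            ≈⟨ ∑-comm (λ i (k : Fin (suc E)) → term (toℕ k) (E ∸ toℕ k) i) ⟩
          ∑[ k < suc E ] ∑[ i < n ] term (toℕ k) (E ∸ toℕ k) i ∎))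
          (∣-sum _ λ (k : Fin (suc E)) → ∣-sum-term (toℕ k))

degree-bound : ∀ {i l r N M S} → i ≤ r → l ≤ N ℕ.+ M → M ℕ.+ r ≤ S → i ℕ.+ l ≤ N ℕ.+ S
degree-bound {i} {l} {r} {N} {M} {S} i≤r l≤E M+r≤S = begin
  i ℕ.+ l           ≤⟨ ℕ.+-mono-≤ i≤r l≤E ⟩
  r ℕ.+ (N ℕ.+ M)   ≡⟨ ≡.trans (ℕ.+-comm r (N ℕ.+ M)) (ℕ.+-assoc N M r) ⟩
  N ℕ.+ (M ℕ.+ r)   ≤⟨ ℕ.+-monoʳ-≤ N M+r≤S ⟩
  N ℕ.+ S           ∎
  where open ℕ.≤-Reasoning

-- Polynomials over a field: divided differences, roots with multiplicity, Stepanov's polynomial.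

module Field {o ℓ} (K : CommutativeRing o ℓ)
  (recip : ∀ x → ¬ CommutativeRing._≈_ K x (CommutativeRing.0# K) →
           ∃ λ y → CommutativeRing._≈_ K (CommutativeRing._*_ K x y) (CommutativeRing.1# K))
  (1≉0 : ¬ CommutativeRing._≈_ K (CommutativeRing.1# K) (CommutativeRing.0# K)) where

  open CommutativeRing K hiding (zero)
  open RingIdentities K using (sub-add; pascal-terms; coef-term; moment-split)
  open Polynomials K
  open import Algebra.Properties.Ring ring using (-0#≈0#; -‿distribʳ-*; -‿distribˡ-*; -1*x≈-x; -‿involutive; x∙y⁻¹≈ε⇒x≈y)
  open import Algebra.Properties.Semiring.Sum semiring
  open import Algebra.Properties.Semiring.Mult semiring renaming (_×_ to _·_)
  open import Algebra.Properties.Semiring.Exp semiring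
  open import Algebra.Properties.CommutativeSemiring.Exp commutativeSemiring using (^-distrib-*)
  open Divisibility K using () renaming (×≈×1* to ·≈·1*)
  open import Relation.Binary.Reasoning.Setoid setoid

  module Q = CommutativeRing polynomialRing
  module D = Divisibility polynomialRing
  open import Algebra.Properties.Semiring.Exp Q.semiring using () renaming (_^_ to _^ᴾ_; ^-congˡ to ^ᴾ-congˡ)
  open import Algebra.Properties.Semiring.Mult Q.semiring using () renaming (_×_ to _·ᴾ_)
  open import Algebra.Properties.Semiring.Sum Q.semiring using () renaming (sum to sumᴾ; sum-cong-≋ to sumᴾ-cong)

  *-≉0 : ∀ {x y} → ¬ x ≈ 0# → ¬ y ≈ 0# → ¬ x * y ≈ 0#
  *-≉0 {x} {y} x≉0 y≉0 xy≈0 with x⁻¹ , xx⁻¹≈1 ← recip x x≉0 = y≉0 (begin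
    y                ≈⟨ *-identityˡ y ⟨
    1# * y           ≈⟨ *-congʳ (trans (sym xx⁻¹≈1) (*-comm x x⁻¹)) ⟩
    x⁻¹ * x * y      ≈⟨ *-assoc x⁻¹ x y ⟩
    x⁻¹ * (x * y)    ≈⟨ *-congˡ xy≈0 ⟩
    x⁻¹ * 0#         ≈⟨ zeroʳ x⁻¹ ⟩
    0#               ∎)

  ^-≉0 : ∀ {x} n → ¬ x ≈ 0# → ¬ x ^ n ≈ 0#
  ^-≉0 zero    x≉0 = 1≉0
  ^-≉0 (suc n) x≉0 = *-≉0 x≉0 (^-≉0 n x≉0)

  1^n≈1 : ∀ n → 1# ^ n ≈ 1#
  1^n≈1 zero    = refl
  1^n≈1 (suc n) = trans (*-identityˡ _) (1^n≈1 n)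

  -- The coefficients of the divided difference at the points b.
  moments : ∀ n (b : Fin (suc n) → Carrier) → (∀ i j → b i ≈ b j → i ≡ j) →
    ∃ λ (c : Fin (suc n) → Carrier) →
      (∀ j → j < n → ∑[ i < suc n ] (c i * b i ^ j) ≈ 0#) × ∑[ i < suc n ] (c i * b i ^ n) ≈ 1#
  moments zero    b b-inj = (λ _ → 1#) , (λ _ ()) , trans (+-identityʳ _) (*-identityˡ 1#)
  moments (suc n) b b-inj with c , low , top ← moments n (b ∘ suc) (λ i j eq → Fin.suc-injective (b-inj (suc i) (suc j) eq))
    = c′ , low′ , trans (recurrence n) (trans (+-cong (trans (*-congˡ (low′ n ℕ.≤-refl)) (zeroʳ _)) top) (+-identityˡ 1#))
    where
    gap : Fin (suc n) → Carrier
    gap i = b (suc i) + - b zero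
    inverse-gap : ∀ i → ∃ λ y → gap i * y ≈ 1#
    inverse-gap i = recip (gap i) λ gap≈0 → contradiction (b-inj (suc i) zero (x∙y⁻¹≈ε⇒x≈y _ _ gap≈0)) λ ()
    d : Fin (suc n) → Carrier
    d i = c i * proj₁ (inverse-gap i)
    c′ : Fin (suc (suc n)) → Carrier
    c′ zero    = - sum d
    c′ (suc i) = d i
    μ′ : ℕ → Carrier
    μ′ j = ∑[ i < suc (suc n) ] (c′ i * b i ^ j)
    μ′0 : μ′ 0 ≈ 0#
    μ′0 = trans (+-cong (*-identityʳ _) (sum-cong-≋ λ i → *-identityʳ (d i))) (-‿inverseˡ (sum d))
    -- Writing b (suc i) = b zero + gap i and d i · gap i = c i reduces each moment to the previous
    -- one and to a moment of the points without b zero. The weight `- sum d` makes the zeroth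
    -- moment vanish and starts the induction.
    recurrence : ∀ j → μ′ (suc j) ≈ b zero * μ′ j + ∑[ i < suc n ] (c i * b (suc i) ^ j)
    recurrence j = begin
      - sum d * (b zero * b zero ^ j) + ∑[ i < suc n ] (d i * (b (suc i) * b (suc i) ^ j))
        ≈⟨ +-cong (trans (sym (*-assoc _ _ _)) (trans (*-congʳ (*-comm _ _)) (*-assoc _ _ _)))
                  (trans (sum-cong-≋ split) (∑-distrib-+ (λ i → b zero * (d i * b (suc i) ^ j)) (λ i → c i * b (suc i) ^ j))) ⟩
      b zero * (- sum d * b zero ^ j) + (∑[ i < suc n ] (b zero * (d i * b (suc i) ^ j)) + S)
        ≈⟨ +-assoc _ _ _ ⟨
      b zero * (- sum d * b zero ^ j) + ∑[ i < suc n ] (b zero * (d i * b (suc i) ^ j)) + S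
        ≈⟨ +-congʳ (trans (distribˡ _ _ _) (+-congˡ (*-distribˡ-sum (b zero) (λ i → d i * b (suc i) ^ j)))) ⟨
      b zero * μ′ j + S ∎
      where
      S = ∑[ i < suc n ] (c i * b (suc i) ^ j)
      split : ∀ i → d i * (b (suc i) * b (suc i) ^ j) ≈ b zero * (d i * b (suc i) ^ j) + c i * b (suc i) ^ j
      split i = begin
        d i * (b (suc i) * b (suc i) ^ j)
          ≈⟨ *-congˡ (*-congʳ (sub-add (b (suc i)) (b zero))) ⟩
        d i * ((b zero + gap i) * b (suc i) ^ j)
          ≈⟨ moment-split (c i) (proj₁ (inverse-gap i)) (b zero) (gap i) (b (suc i) ^ j) ⟩
        b zero * (d i * b (suc i) ^ j) + c i * (gap i * proj₁ (inverse-gap i) * b (suc i) ^ j)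
          ≈⟨ +-congˡ (*-congˡ (trans (*-congʳ (proj₂ (inverse-gap i))) (*-identityˡ _))) ⟩
        b zero * (d i * b (suc i) ^ j) + c i * b (suc i) ^ j ∎
    low′ : ∀ j → j < suc n → μ′ j ≈ 0#
    low′ zero    _         = μ′0
    low′ (suc j) (s≤s j<n) = trans (recurrence j)
      (trans (+-cong (trans (*-congˡ (low′ j (ℕ.<-trans j<n (ℕ.n<1+n n)))) (zeroʳ _)) (low j j<n)) (+-identityˡ 0#))

  coef-power : ∀ u v n i → coef (linear u v ^ᴾ n) i ≈ (n C i) · (u ^ i * v ^ (n ∸ i))
  coef-power u v zero    zero    = trans (coef-constant-0 1#) (sym (trans (+-identityʳ _) (*-identityˡ 1#)))
  coef-power u v zero    (suc i) = coef-constant-suc 1# i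
  coef-power u v (suc n) zero    = begin
    coef (linear u v ⊛ (linear u v ^ᴾ n)) 0 ≈⟨ coef-linear-*-0 u v (linear u v ^ᴾ n) ⟩
    v * coef (linear u v ^ᴾ n) 0     ≈⟨ *-congˡ (trans (coef-power u v n 0) (trans (+-identityʳ _) (*-identityˡ _))) ⟩
    v * v ^ n                        ≈⟨ trans (+-identityʳ _) (*-identityˡ _) ⟨
    1 · (1# * v ^ suc n)             ∎
  coef-power u v (suc n) (suc i) = begin
    coef (linear u v ⊛ (linear u v ^ᴾ n)) (suc i)
      ≈⟨ coef-linear-* u v (linear u v ^ᴾ n) i ⟩
    v * coef (linear u v ^ᴾ n) (suc i) + u * coef (linear u v ^ᴾ n) i
      ≈⟨ +-cong (*-congˡ (coef-power u v n (suc i))) (*-congˡ (coef-power u v n i)) ⟩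
    v * ((n C suc i) · (u ^ suc i * v ^ (n ∸ suc i))) + u * ((n C i) · (u ^ i * v ^ (n ∸ i)))
      ≈⟨ +-cong (*-congˡ (·≈·1* (n C suc i) _)) (*-congˡ (·≈·1* (n C i) _)) ⟩
    v * (P * (u * u ^ i * v ^ (n ∸ suc i))) + u * (S * (u ^ i * v ^ (n ∸ i)))
      ≈⟨ step ⟩
    (S + P) * (u * u ^ i * v ^ (n ∸ i))
      ≈⟨ *-congʳ (×-homo-+ 1# (n C i) (n C suc i)) ⟨
    ((n C i ℕ.+ n C suc i) · 1#) * (u ^ suc i * v ^ (n ∸ i))
      ≈⟨ *-congʳ (×-congˡ (nCk+nC[k+1]≡[n+1]C[k+1] n i)) ⟩
    ((suc n C suc i) · 1#) * (u ^ suc i * v ^ (n ∸ i))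
      ≈⟨ ·≈·1* (suc n C suc i) _ ⟨
    (suc n C suc i) · (u ^ suc i * v ^ (n ∸ i)) ∎
    where
    P = (n C suc i) · 1#
    S = (n C i) · 1#
    step : v * (P * (u * u ^ i * v ^ (n ∸ suc i))) + u * (S * (u ^ i * v ^ (n ∸ i))) ≈ (S + P) * (u * u ^ i * v ^ (n ∸ i))
    step with i ℕ.<? n
    ... | yes i<n = trans (+-congˡ (*-congˡ (*-congˡ (*-congˡ v^≈)))) (trans (pascal-terms v u P S (u ^ i) (v ^ (n ∸ suc i))) (*-congˡ (*-congˡ (sym v^≈))))
      where
      v^≈ : v ^ (n ∸ i) ≈ v ^ suc (n ∸ suc i)
      v^≈ = ^-congʳ v (ℕ.+-∸-assoc 1 i<n)
    -- Truncated subtraction breaks v · v^(n - (i + 1)) = v^(n - i) here, but its coefficient C(n, i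
    -- + 1) is zero.
    ... | no  i≮n = begin
      v * (P * (u * u ^ i * v ^ (n ∸ suc i))) + u * (S * (u ^ i * v ^ (n ∸ i)))
        ≈⟨ +-congʳ (trans (*-congˡ (trans (*-congʳ P≈0) (zeroˡ _))) (zeroʳ v)) ⟩
      0# + u * (S * (u ^ i * v ^ (n ∸ i)))
        ≈⟨ trans (+-identityˡ _) (trans (sym (*-assoc _ _ _)) (trans (*-congʳ (*-comm u S)) (trans (*-assoc _ _ _) (*-congˡ (sym (*-assoc _ _ _)))))) ⟩
      S * (u * u ^ i * v ^ (n ∸ i))
        ≈⟨ *-congʳ (trans (+-congˡ P≈0) (+-identityʳ S)) ⟨
      (S + P) * (u * u ^ i * v ^ (n ∸ i)) ∎
      where
      P≈0 : P ≈ 0#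
      P≈0 = ×-congˡ (k>n⇒nCk≡0 (s≤s (ℕ.≮⇒≥ i≮n)))

  monic : Carrier → Poly
  monic a = linear 1# (- a)

  degreeBelow-resp : ∀ n f g → f ≋ g → DegreeBelow n f → DegreeBelow n g
  degreeBelow-resp n f g f≋g deg i n≤i = trans (sym (coef≈ f≋g i)) (deg i n≤i)

  degreeBelow-monic : ∀ a n f → DegreeBelow (suc n) (monic a ⊛ f) → DegreeBelow n f
  degreeBelow-monic a n f deg i n≤i = descend (suc (bound f)) i n≤i (ℕ.m≤n+m _ i)
    where
    -- coef f i = a · coef f (i + 1) for i ≥ n, and the coefficients eventually vanish.
    descend : ∀ d i → n ≤ i → bound f < i ℕ.+ d → coef f i ≈ 0#
    descend zero    i n≤i b< = vanish f i (≡.subst (bound f <_) (ℕ.+-identityʳ i) b<)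
    descend (suc d) i n≤i b< = begin
      coef f i                                  ≈⟨ +-identityˡ _ ⟨
      0# + coef f i                             ≈⟨ +-cong (trans (*-congˡ (descend d (suc i) (ℕ.m≤n⇒m≤1+n n≤i) (≡.subst (bound f <_) (ℕ.+-suc i d) b<))) (zeroʳ _)) (*-identityˡ _) ⟨
      - a * coef f (suc i) + 1# * coef f i      ≈⟨ coef-linear-* 1# (- a) f i ⟨
      coef (monic a ⊛ f) (suc i)                ≈⟨ deg (suc i) (s≤s n≤i) ⟩
      0#                                        ∎

  degreeBelow-monic^ : ∀ a R n f → DegreeBelow (R ℕ.+ n) ((monic a ^ᴾ R) ⊛ f) → DegreeBelow n f
  degreeBelow-monic^ a zero    n f deg = degreeBelow-resp n _ f (Q.*-identityˡ f) deg
  degreeBelow-monic^ a (suc R) n f deg = degreeBelow-monic^ a R n f (degreeBelow-monic a (R ℕ.+ n) g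
    (degreeBelow-resp _ _ (monic a ⊛ g) (Q.*-assoc (monic a) (monic a ^ᴾ R) f) deg))
    where g = (monic a ^ᴾ R) ⊛ f

  degreeBelow-∏ : ∀ {m} (a : Fin m → Carrier) R n f →
    DegreeBelow (m ℕ.* R ℕ.+ n) (D.∏ (λ i → monic (a i) ^ᴾ R) ⊛ f) → DegreeBelow n f
  degreeBelow-∏ {zero}  a R n f deg = degreeBelow-resp n _ f (Q.*-identityˡ f) deg
  degreeBelow-∏ {suc m} a R n f deg = degreeBelow-∏ (a ∘ suc) R n f
    (degreeBelow-monic^ (a zero) R (m ℕ.* R ℕ.+ n) g
      (≡.subst (λ k → DegreeBelow k ((monic (a zero) ^ᴾ R) ⊛ g)) (ℕ.+-assoc R (m ℕ.* R) n)
        (degreeBelow-resp _ _ ((monic (a zero) ^ᴾ R) ⊛ g) (Q.*-assoc (monic (a zero) ^ᴾ R) U f) deg)))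
    where
    U = D.∏ (λ i → monic (a (suc i)) ^ᴾ R)
    g = U ⊛ f

  coprime-monic : ∀ {a b} → ¬ a ≈ b → D.Coprime (monic a) (monic b)
  coprime-monic {a} {b} a≉b with y , [a-b]y≈1 ← recip (a + - b) (a≉b ∘ x∙y⁻¹≈ε⇒x≈y a b) =
    constant (- y) , constant y , Q.trans (linear-combination (- y) 1# (- a) y 1# (- b)) (linear-constant
      (trans (+-cong (*-identityʳ _) (*-identityʳ _)) (-‿inverseˡ y))
      (begin
        - y * - a + y * - b   ≈⟨ +-congʳ (trans (sym (-‿distribˡ-* y (- a))) (trans (-‿cong (sym (-‿distribʳ-* y a))) (-‿involutive _))) ⟩
        y * a + y * - b       ≈⟨ distribˡ y a (- b) ⟨
        y * (a + - b)         ≈⟨ trans (*-comm _ _) [a-b]y≈1 ⟩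
        1#                    ∎))

  coprime-monic^ : ∀ {a b} R → ¬ a ≈ b → D.Coprime (monic a ^ᴾ R) (monic b ^ᴾ R)
  coprime-monic^ {a} {b} R a≉b = D.coprime-^ {monic a ^ᴾ R} {monic b} R
    (D.coprime-sym {monic b} {monic a ^ᴾ R} (D.coprime-^ {monic b} {monic a} R
      (D.coprime-sym {monic a} {monic b} (coprime-monic a≉b))))

  -- The powers (X - a_i)^R are pairwise comaximal, so their product divides f. The product is monic
  -- of degree mR, which forces every coefficient of the cofactor to vanish.
  many-roots : ∀ {m} (a : Fin m → Carrier) → (∀ i j → a i ≈ a j → i ≡ j) → ∀ R f →
    (∀ i → (monic (a i) ^ᴾ R) D.∣ f) → DegreeBelow (m ℕ.* R) f → ∀ i → coef f i ≈ 0#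
  many-roots {m} a a-inj R f roots deg i = from-divisor
    (D.coprime-∏-∣ {x = f} (λ i → monic (a i) ^ᴾ R) (λ i j i≢j → coprime-monic^ R (i≢j ∘ a-inj i j)) roots)
    where
    U = D.∏ (λ i → monic (a i) ^ᴾ R)
    from-divisor : U D.∣ f → coef f i ≈ 0#
    from-divisor (g , f≋) = begin
      coef f i                                     ≈⟨ coef≈ f≋ i ⟩
      coef (U ⊛ g) i                               ≈⟨ coef-⊛ U g i ⟩
      antidiagonal (λ k l → coef U k * coef g l) i ≈⟨ antidiagonal-cong i (λ k l _ → trans (*-congˡ (g≈0 l z≤n)) (zeroʳ _)) ⟩
      antidiagonal (λ _ _ → 0#) i                  ≈⟨ antidiagonal-0 i ⟩
      0#                                           ∎
      where
      g≈0 : DegreeBelow 0 g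
      g≈0 = degreeBelow-∏ a R 0 g
        (≡.subst (λ k → DegreeBelow k (U ⊛ g)) (≡.sym (ℕ.+-identityʳ (m ℕ.* R))) (degreeBelow-resp _ f (U ⊛ g) f≋ deg))

  constant-^ : ∀ x n → constant x ^ᴾ n ≋ constant (x ^ n)
  constant-^ x zero    = Q.refl
  constant-^ x (suc n) = Q.trans (Q.*-congˡ (constant-^ x n)) (constant-* x (x ^ n))

  constant-· : ∀ n → n ·ᴾ constant 1# ≋ constant (n · 1#)
  constant-· zero    = Q.refl
  constant-· (suc n) = Q.trans (Q.+-congˡ (constant-· n)) (constant-+ 1# (n · 1#))

  constant-sum : ∀ {n} (t : Fin n → Carrier) → sumᴾ (λ i → constant (t i)) ≋ constant (sum t)
  constant-sum {zero}  t = Q.refl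
  constant-sum {suc n} t = Q.trans (Q.+-congˡ (constant-sum (t ∘ suc))) (constant-+ (t zero) (sum (t ∘ suc)))

  coef-sum : ∀ {n} (t : Fin n → Poly) i → coef (sumᴾ t) i ≈ sum (λ x → coef (t x) i)
  coef-sum {zero}  t zero    = coef-constant-0 0#
  coef-sum {zero}  t (suc i) = coef-constant-suc 0# i
  coef-sum {suc n} t i       = trans (coef-⊕ (t zero) (sumᴾ (t ∘ suc)) i) (+-congˡ (coef-sum (t ∘ suc) i))

  antidiagonal-sum : ∀ {m} (w : Fin m → ℕ → ℕ → Carrier) n →
    ∑[ x < m ] antidiagonal (w x) n ≈ antidiagonal (λ i l → ∑[ x < m ] w x i l) n
  antidiagonal-sum w zero    = refl
  antidiagonal-sum w (suc n) = trans (∑-distrib-+ (λ x → w x 0 (suc n)) (λ x → antidiagonal (w x ∘ suc) n))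
    (+-congˡ (antidiagonal-sum (λ x → w x ∘ suc) n))

  module Stepanov {n R : ℕ} (b c : Fin n → Carrier) (b-inj : ∀ i j → b i ≈ b j → i ≡ j)
    (μ≈0 : ∀ j → j < suc (R ℕ.+ R) → ∑[ x < n ] (c x * b x ^ j) ≈ 0#)
    (μ≈1 : ∑[ x < n ] (c x * b x ^ suc (R ℕ.+ R)) ≈ 1#)
    (lam : Carrier) (lam≉0 : ¬ lam ≈ 0#) (N : ℕ)
    (fixed : ∀ i j → ¬ i ≡ j → (b i * b j + lam) ^ suc N ≈ b i * b j + lam)
    (M v s t : ℕ)
    (low-order : ∀ k → k < R → k < M ⊎ ((N ℕ.+ M) C k) · 1# ≈ 0#)
    (C[t]≉0 : ¬ ((N ℕ.+ M) C t) · 1# ≈ 0#)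
    (C[v]≉0 : ¬ ((v ℕ.+ s) C v) · 1# ≈ 0#)
    (s+t≡ : s ℕ.+ t ≡ suc (R ℕ.+ R))
    (high-order : ∀ l → t < l → l ≤ t ℕ.+ v → ((N ℕ.+ M) C l) · 1# ≈ 0#)
    (M+r≤ : M ℕ.+ (v ℕ.+ s) ≤ R ℕ.+ R)
    (R≤r : R ≤ v ℕ.+ s)
    (small : N ℕ.+ (R ℕ.+ R) < n ℕ.* R) where

    private
      r = v ℕ.+ s
      E = N ℕ.+ M
      X = linear 1# 0#

      μ : ℕ → Carrier
      μ j = ∑[ x < n ] (c x * b x ^ j)

      module V = D.Moments (constant ∘ c) (constant ∘ b) (R ℕ.+ R) (λ j j≤ → Q.trans
        (sumᴾ-cong {n} λ x → Q.trans (Q.*-congˡ (constant-^ (b x) j)) (constant-* (c x) (b x ^ j)))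
        (Q.trans (constant-sum (λ x → c x * b x ^ j)) (constant-cong (μ≈0 j (s≤s j≤)))))

      f = V.combination X (constant lam) r E

      τ≋ : ∀ i j → (constant (b i) ⊛ constant (b j)) ⊕ constant lam ≋ constant (b i * b j + lam)
      τ≋ i j = Q.trans (Q.+-congʳ (constant-* (b i) (b j))) (constant-+ _ lam)

      roots : ∀ j → (monic (b j) ^ᴾ R) D.∣ f
      roots j = proj₁ divides , Q.trans (proj₂ divides) (Q.*-congʳ (^ᴾ-congˡ R (X-constant (b j))))
        where
        divides = V.∣-combination X (constant lam) j R r N M R≤r M+r≤
          (λ i i≢j → Q.trans (^ᴾ-congˡ (suc N) (τ≋ i j)) (Q.trans (constant-^ _ (suc N))
            (Q.trans (constant-cong (fixed i j i≢j)) (Q.sym (τ≋ i j)))))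
          (λ k k<R → Sum.map₂ (λ C≈0 → Q.trans (constant-· (E C k)) (constant-cong C≈0)) (low-order k k<R))

      -- The part of the (i, l) contribution to a coefficient of f that does not depend on the
      -- point; the rest adds up to the moment of index r - i + l.
      κ : ℕ → ℕ → Carrier
      κ i l = ((r C i) · 1#) * ((E C l) · 1#) * ((- 1#) ^ (r ∸ i) * lam ^ (E ∸ l))

      κ≈0ˡ : ∀ i l → (r C i) · 1# ≈ 0# → κ i l ≈ 0#
      κ≈0ˡ i l C≈0 = trans (*-congʳ (trans (*-congʳ C≈0) (zeroˡ _))) (zeroˡ _)

      κ≈0ʳ : ∀ i l → (E C l) · 1# ≈ 0# → κ i l ≈ 0#
      κ≈0ʳ i l C≈0 = trans (*-congʳ (trans (*-congˡ C≈0) (zeroʳ _))) (zeroˡ _)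

      term≈ : ∀ x i l → c x * (coef (monic (b x) ^ᴾ r) i * coef (linear (b x) lam ^ᴾ E) l) ≈
                        κ i l * (c x * b x ^ (r ∸ i ℕ.+ l))
      term≈ x i l = begin
        c x * (coef (monic (b x) ^ᴾ r) i * coef (linear (b x) lam ^ᴾ E) l)
          ≈⟨ *-congˡ (*-cong
               (trans (coef-power 1# (- b x) r i) (trans (·≈·1* (r C i) _) (*-congˡ
                 (trans (*-congʳ (1^n≈1 i)) (trans (*-identityˡ _) (trans (^-congˡ (r ∸ i) (sym (-1*x≈-x (b x)))) (^-distrib-* (- 1#) (b x) (r ∸ i))))))))
               (trans (coef-power (b x) lam E l) (·≈·1* (E C l) _))) ⟩
        c x * ((((r C i) · 1#) * ((- 1#) ^ (r ∸ i) * b x ^ (r ∸ i))) * (((E C l) · 1#) * (b x ^ l * lam ^ (E ∸ l))))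
          ≈⟨ coef-term (c x) _ _ (b x ^ (r ∸ i)) _ (b x ^ l) _ ⟩
        κ i l * (c x * (b x ^ (r ∸ i) * b x ^ l))
          ≈⟨ *-congˡ (*-congˡ (^-homo-* (b x) (r ∸ i) l)) ⟨
        κ i l * (c x * b x ^ (r ∸ i ℕ.+ l)) ∎

      f-term : Fin n → Poly
      f-term x = constant (c x) ⊛ (((X ⊕ (⊖ constant (b x))) ^ᴾ r) ⊛ (((constant (b x) ⊛ X) ⊕ constant lam) ^ᴾ E))

      coef-f : ∀ k → coef f k ≈ antidiagonal (λ i l → κ i l * μ (r ∸ i ℕ.+ l)) k
      coef-f k = begin
        coef f k
          ≈⟨ coef-sum f-term k ⟩
        ∑[ x < n ] coef (f-term x) k
          ≈⟨ sum-cong-≋ (λ x → trans (coef-constant-* (c x) _ k)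
               (*-congˡ (trans (coef≈ (Q.*-cong (^ᴾ-congˡ r (X-constant (b x))) (^ᴾ-congˡ E (constant-*-X (b x) lam))) k)
               (coef-⊛ (monic (b x) ^ᴾ r) (linear (b x) lam ^ᴾ E) k)))) ⟩
        ∑[ x < n ] (c x * antidiagonal (λ i l → coef (monic (b x) ^ᴾ r) i * coef (linear (b x) lam ^ᴾ E) l) k)
          ≈⟨ sum-cong-≋ (λ x → trans (sym (antidiagonal-* (c x) _ k)) (antidiagonal-cong k λ i l _ → term≈ x i l)) ⟩
        ∑[ x < n ] antidiagonal (λ i l → κ i l * (c x * b x ^ (r ∸ i ℕ.+ l))) k
          ≈⟨ antidiagonal-sum (λ x i l → κ i l * (c x * b x ^ (r ∸ i ℕ.+ l))) k ⟩
        antidiagonal (λ i l → ∑[ x < n ] (κ i l * (c x * b x ^ (r ∸ i ℕ.+ l)))) k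
          ≈⟨ antidiagonal-cong k (λ i l _ → sym (*-distribˡ-sum (κ i l) (λ x → c x * b x ^ (r ∸ i ℕ.+ l)))) ⟩
        antidiagonal (λ i l → κ i l * μ (r ∸ i ℕ.+ l)) k ∎

      term : ℕ → ℕ → Carrier
      term i l = κ i l * μ (r ∸ i ℕ.+ l)

      term≈0ˡ : ∀ i l → r < i → term i l ≈ 0#
      term≈0ˡ i l r<i = trans (*-congʳ (κ≈0ˡ i l (×-congˡ (k>n⇒nCk≡0 r<i)))) (zeroˡ _)

      term≈0ʳ : ∀ i l → (E C l) · 1# ≈ 0# → term i l ≈ 0#
      term≈0ʳ i l C≈0 = trans (*-congʳ (κ≈0ʳ i l C≈0)) (zeroˡ _)

      degree : DegreeBelow (n ℕ.* R) f
      degree k nR≤k = trans (coef-f k) (trans (antidiagonal-cong k term≈0) (antidiagonal-0 k))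
        where
        term≈0 : ∀ i l → i ℕ.+ l ≡ k → term i l ≈ 0#
        term≈0 i l i+l≡k =
          [ (λ i≤r → [ (λ l≤E → contradiction (ℕ.≤-<-trans (≡.subst (_≤ N ℕ.+ (R ℕ.+ R)) i+l≡k (degree-bound {i} {l} {r} {N} {M} i≤r l≤E M+r≤)) small) (ℕ.≤⇒≯ nR≤k))
                     , (λ E<l → term≈0ʳ i l (×-congˡ (k>n⇒nCk≡0 E<l))) ]′ (ℕ.≤-<-connex l E))
          , term≈0ˡ i l ]′ (ℕ.≤-<-connex i r)

      -- Terms with l < t carry a moment of index below 2R + 1; for l > t the factor C(E, l)
      -- vanishes in the field. The term l = t carries the moment 2R + 1, which is 1.
      coef-leading : coef f (v ℕ.+ t) ≈ κ v t
      coef-leading = begin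
        coef f (v ℕ.+ t)                 ≈⟨ coef-f (v ℕ.+ t) ⟩
        antidiagonal (λ i l → κ i l * μ (r ∸ i ℕ.+ l)) (v ℕ.+ t)
                                         ≈⟨ antidiagonal-single term v t other ⟩
        κ v t * μ (r ∸ v ℕ.+ t)          ≡⟨ ≡.cong (λ j → κ v t * μ j) (≡.trans (≡.cong (ℕ._+ t) (ℕ.m+n∸m≡n v s)) s+t≡) ⟩
        κ v t * μ (suc (R ℕ.+ R))        ≈⟨ *-congˡ μ≈1 ⟩
        κ v t * 1#                       ≈⟨ *-identityʳ _ ⟩
        κ v t                            ∎
        where
        lower : ∀ i l → i ℕ.+ l ≡ v ℕ.+ t → l < t → r ∸ i ℕ.+ l < suc (R ℕ.+ R)
        lower i l i+l≡v+t l<t = ≡.subst (r ∸ i ℕ.+ l <_) s+t≡ (ℕ.+-mono-≤-<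
          (≡.subst (r ∸ i ≤_) (ℕ.m+n∸m≡n v s) (ℕ.∸-monoʳ-≤ r v≤i)) l<t)
          where
          v≤i : v ≤ i
          v≤i = ℕ.+-cancelʳ-≤ t v i (≡.subst (_≤ i ℕ.+ t) i+l≡v+t (ℕ.+-monoʳ-≤ i (ℕ.<⇒≤ l<t)))
        other : ∀ i l → i ℕ.+ l ≡ v ℕ.+ t → ¬ l ≡ t → term i l ≈ 0#
        other i l i+l≡v+t l≢t =
          [ (λ l<t → trans (*-congˡ (μ≈0 (r ∸ i ℕ.+ l) (lower i l i+l≡v+t l<t))) (zeroʳ (κ i l)))
          , (λ t<l → term≈0ʳ i l (high-order l t<l (≡.subst (l ≤_) (≡.trans i+l≡v+t (ℕ.+-comm v t)) (ℕ.m≤n+m l i))))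
          ]′ (Sum.map₁ (λ l≤t → ℕ.≤∧≢⇒< l≤t l≢t) (ℕ.≤-<-connex l t))

      leading≉0 : ¬ κ v t ≈ 0#
      leading≉0 = *-≉0 (*-≉0 C[v]≉0 C[t]≉0) (*-≉0 (^-≉0 s′ -1≉0) (^-≉0 (E ∸ t) lam≉0))
        where
        s′ = r ∸ v
        -1≉0 : ¬ - 1# ≈ 0#
        -1≉0 -1≈0 = 1≉0 (trans (sym (-‿involutive 1#)) (trans (-‿cong -1≈0) -0#≈0#))

    no-small-degree : ⊥
    no-small-degree = leading≉0 (trans (sym coef-leading) (many-roots b b-inj R f roots degree (v ℕ.+ t)))

  stepanov : ∀ {R} (b : Fin (suc (suc (R ℕ.+ R))) → Carrier) → (∀ i j → b i ≈ b j → i ≡ j) →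
    ∀ lam → ¬ lam ≈ 0# → ∀ N → (∀ i j → ¬ i ≡ j → (b i * b j + lam) ^ suc N ≈ b i * b j + lam) →
    ∀ M v s t →
    (∀ k → k < R → k < M ⊎ ((N ℕ.+ M) C k) · 1# ≈ 0#) →
    ¬ ((N ℕ.+ M) C t) · 1# ≈ 0# →
    ¬ ((v ℕ.+ s) C v) · 1# ≈ 0# →
    s ℕ.+ t ≡ suc (R ℕ.+ R) →
    (∀ l → t < l → l ≤ t ℕ.+ v → ((N ℕ.+ M) C l) · 1# ≈ 0#) →
    M ℕ.+ (v ℕ.+ s) ≤ R ℕ.+ R →
    R ≤ v ℕ.+ s →
    ¬ N ℕ.+ (R ℕ.+ R) < suc (suc (R ℕ.+ R)) ℕ.* R
  stepanov {R} b b-inj =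
    let c , μ≈0 , μ≈1 = moments (suc (R ℕ.+ R)) b b-inj in Stepanov.no-small-degree b c b-inj μ≈0 μ≈1

open import Defs
open import Data.Nat using (_+_; _*_; _^_)
open import Data.Nat.Divisibility using (_∣_; divides; ∣⇒≤; ∣m+n∣m⇒∣n; ∣n⇒∣m*n; m∣m*n)
open import Data.Nat.Primality using (Prime; prime⇒nonTrivial; prime⇒irreducible)
open import Data.Nat.Coprimality using (Coprime; coprime-Bézout)
open import Data.Nat.GCD using (module Bézout)
open import Data.Nat.Tactic.RingSolver using (solve-∀)
open import Data.Fin using (punchIn; inject≤)
open import Data.Fin.Permutation using (Permutation; _⟨$⟩ʳ_)
open import Function using (Inverse; mk↔ₛ′; _↔_)
open import Function.Construct.Composition using (_↔-∘_)
open import Function.Construct.Symmetry using (↔-sym)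
open import Function.Properties.Inverse using (↔⇒↣)
open import Relation.Nullary using (Dec)
open import Relation.Nullary.Decidable using (via-injection)
open import Relation.Binary.PropositionalEquality
open Arithmetic

-- Finite fields: Fermat's theorem and the characteristic.

module FiniteFieldProperties {q} (F : FiniteField q) where

  open FiniteField F using (card; isCommutativeRing; 0≢1; inverse; InS) renaming (_^_ to _^ꟳ_)

  commutativeRing : CommutativeRing 0ℓ 0ℓ
  commutativeRing = record { isCommutativeRing = isCommutativeRing }

  open CommutativeRing commutativeRing hiding (zero; refl; sym; trans)
    renaming (_+_ to _⊕_; _*_ to _⊛_; -_ to ⊖_)
  open Field commutativeRing inverse (0≢1 ∘ sym) using (*-≉0; ^-≉0)
  open import Algebra.Properties.Ring ring using (+-cancelˡ; x∙y⁻¹≈ε⇒x≈y)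
  open import Algebra.Properties.Semiring.Mult semiring using (×1-homo-*) renaming (_×_ to _·_)
  open import Algebra.Properties.Semiring.Exp semiring using (^-assocʳ) renaming (_^_ to _^ᴿ_)
  import Algebra.Properties.CommutativeMonoid.Sum +-commutativeMonoid as Σ
  import Algebra.Properties.CommutativeMonoid.Sum *-commutativeMonoid as Π

  infix 4 _≟_
  _≟_ : (x y : Carrier) → Dec (x ≡ y)
  _≟_ = via-injection (↔⇒↣ card) Fin._≟_

  index : Carrier → Fin q
  index = Inverse.to card

  element : Fin q → Carrier
  element = Inverse.from card

  element-index : ∀ x → element (index x) ≡ x
  element-index = Inverse.strictlyInverseʳ card

  index-element : ∀ i → index (element i) ≡ i
  index-element = Inverse.strictlyInverseˡ card

  relabel : Carrier ↔ Carrier → Permutation q q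
  relabel π = (card ↔-∘ π) ↔-∘ ↔-sym card

  -- Adding 1 permutes the field, so the sum of all elements equals itself plus q · 1.
  q·1≡0 : q · 1# ≡ 0#
  q·1≡0 = +-cancelˡ (Σ.sum element) _ _ (begin
    Σ.sum element ⊕ q · 1#                      ≡⟨ cong (Σ.sum element ⊕_) (Σ.sum-replicate q) ⟨
    Σ.sum element ⊕ Σ.sum {q} (λ _ → 1#)        ≡⟨ Σ.∑-distrib-+ element (λ _ → 1#) ⟨
    Σ.sum (λ i → element i ⊕ 1#)                ≡⟨ Σ.sum-cong-≗ (λ i → element-index (element i ⊕ 1#)) ⟨
    Σ.sum (λ i → element (relabel translation ⟨$⟩ʳ i)) ≡⟨ Σ.sum-permute element (relabel translation) ⟨
    Σ.sum element                               ≡⟨ +-identityʳ _ ⟨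
    Σ.sum element ⊕ 0#                          ∎)
    where
    open ≡-Reasoning
    translation : Carrier ↔ Carrier
    translation = mk↔ₛ′ (_⊕ 1#) (_⊕ (⊖ 1#))
      (λ x → trans (+-assoc x _ _) (trans (cong (x ⊕_) (-‿inverseˡ 1#)) (+-identityʳ x)))
      (λ x → trans (+-assoc x _ _) (trans (cong (x ⊕_) (-‿inverseʳ 1#)) (+-identityʳ x)))

  ^≡^ : ∀ x n → x ^ꟳ n ≡ x ^ᴿ n
  ^≡^ x zero    = refl
  ^≡^ x (suc n) = cong (x ⊛_) (^≡^ x n)

  product-≢0 : ∀ {n} (t : Fin n → Carrier) → (∀ i → ¬ t i ≡ 0#) → ¬ Π.sum t ≡ 0#
  product-≢0 {zero}  t t≢0 = 0≢1 ∘ sym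
  product-≢0 {suc n} t t≢0 = *-≉0 (t≢0 zero) (product-≢0 (t ∘ suc) (t≢0 ∘ suc))

  -- Puts the factor 1 at zero, so that a product over the whole enumeration becomes one over the q
  -- - 1 units.
  onUnits : Carrier → Carrier → Carrier
  onUnits x y with x ≟ 0#
  ... | yes _ = 1#
  ... | no  _ = y

  onUnits-0 : ∀ y → onUnits 0# y ≡ 1#
  onUnits-0 y with 0# ≟ 0#
  ... | yes _   = refl
  ... | no  0≢0 = contradiction refl 0≢0

  onUnits-≢0 : ∀ {x} y → ¬ x ≡ 0# → onUnits x y ≡ y
  onUnits-≢0 {x} y x≢0 with x ≟ 0#
  ... | yes x≡0 = contradiction x≡0 x≢0
  ... | no  _   = refl

  product-onUnits : ∀ y → Π.sum (λ i → onUnits (element i) y) ≡ y ^ᴿ (q ∸ 1)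
  product-onUnits y = helper element (index 0#) (element-index 0#) λ i eq → trans (sym (index-element i)) (cong index eq)
    where
    helper : ∀ {n} (e : Fin n → Carrier) (i₀ : Fin n) → e i₀ ≡ 0# → (∀ i → e i ≡ 0# → i ≡ i₀) →
             Π.sum (λ i → onUnits (e i) y) ≡ y ^ᴿ (n ∸ 1)
    helper {suc n} e i₀ ei₀≡0 e≡0 = begin
      Π.sum (λ i → onUnits (e i) y)                                        ≡⟨ Π.sum-remove {i = i₀} (λ i → onUnits (e i) y) ⟩
      onUnits (e i₀) y ⊛ Π.sum (λ i → onUnits (e (punchIn i₀ i)) y)        ≡⟨ cong₂ _⊛_ (trans (cong (λ x → onUnits x y) ei₀≡0) (onUnits-0 y))
                                                                                (Π.sum-cong-≗ λ i → onUnits-≢0 y (Fin.punchInᵢ≢i i₀ i ∘ e≡0 _)) ⟩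
      1# ⊛ Π.sum {n} (λ _ → y)                                             ≡⟨ *-identityˡ _ ⟩
      Π.sum {n} (λ _ → y)                                                  ≡⟨ Π.sum-replicate n ⟩
      y ^ᴿ n                                                               ∎
      where open ≡-Reasoning

  -- Multiplication by y permutes the units, so their product W satisfies W = y^(q - 1) W, and W is
  -- not zero.
  fermat : ∀ y → ¬ y ≡ 0# → y ^ᴿ (q ∸ 1) ≡ 1#
  fermat y y≢0 with inverse y y≢0
  ... | y⁻¹ , yy⁻¹≡1 = x∙y⁻¹≈ε⇒x≈y _ _ (product-zero (begin
      (y ^ᴿ (q ∸ 1) ⊕ (⊖ 1#)) ⊛ W            ≡⟨ distribʳ W _ _ ⟩
      y ^ᴿ (q ∸ 1) ⊛ W ⊕ (⊖ 1#) ⊛ W          ≡⟨ cong (_⊕ (⊖ 1#) ⊛ W) (trans (cong (_⊛ W) (sym (product-onUnits y))) (sym invariant)) ⟩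
      W ⊕ (⊖ 1#) ⊛ W                         ≡⟨ cong (_⊕ (⊖ 1#) ⊛ W) (*-identityˡ W) ⟨
      1# ⊛ W ⊕ (⊖ 1#) ⊛ W                    ≡⟨ distribʳ W _ _ ⟨
      (1# ⊕ (⊖ 1#)) ⊛ W                      ≡⟨ cong (_⊛ W) (-‿inverseʳ 1#) ⟩
      0# ⊛ W                                 ≡⟨ zeroˡ W ⟩
      0#                                     ∎))
    where
    open ≡-Reasoning
    w : Carrier → Carrier
    w x = onUnits x x
    w≢0 : ∀ x → ¬ w x ≡ 0#
    w≢0 x with x ≟ 0#
    ... | yes _   = 0≢1 ∘ sym
    ... | no  x≢0 = x≢0
    W = Π.sum (w ∘ element)
    product-zero : ∀ {x} → x ⊛ W ≡ 0# → x ≡ 0#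
    product-zero {x} xW≡0 with x ≟ 0#
    ... | yes x≡0 = x≡0
    ... | no  x≢0 = contradiction xW≡0 (*-≉0 x≢0 (product-≢0 (w ∘ element) (w≢0 ∘ element)))
    scaling : Carrier ↔ Carrier
    scaling = mk↔ₛ′ (y ⊛_) (y⁻¹ ⊛_)
      (λ x → trans (sym (*-assoc _ _ x)) (trans (cong (_⊛ x) yy⁻¹≡1) (*-identityˡ x)))
      (λ x → trans (sym (*-assoc _ _ x)) (trans (cong (_⊛ x) (trans (*-comm _ _) yy⁻¹≡1)) (*-identityˡ x)))
    w-scaled : ∀ x → w (y ⊛ x) ≡ onUnits x y ⊛ w x
    w-scaled x with x ≟ 0#
    ... | yes refl = trans (cong w (zeroʳ y)) (trans (onUnits-0 0#) (sym (*-identityˡ 1#)))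
    ... | no  x≢0  = onUnits-≢0 (y ⊛ x) (*-≉0 y≢0 x≢0)
    invariant : W ≡ Π.sum (λ i → onUnits (element i) y) ⊛ W
    invariant = begin
      Π.sum (w ∘ element)                                      ≡⟨ Π.sum-permute (w ∘ element) (relabel scaling) ⟩
      Π.sum (λ i → w (element (index (y ⊛ element i))))        ≡⟨ Π.sum-cong-≗ (λ i → trans (cong w (element-index _)) (w-scaled (element i))) ⟩
      Π.sum (λ i → onUnits (element i) y ⊛ w (element i))      ≡⟨ Π.∑-distrib-+ (λ i → onUnits (element i) y) (w ∘ element) ⟩
      Π.sum (λ i → onUnits (element i) y) ⊛ W                  ∎

  -- For z = y^d one has z^N = y^(q - 1) = 1; the extra factor z lets the same identity cover z = 0.
  power-residue : ∀ d N → q ∸ 1 ≡ d * N → ∀ z → InS d z ⊎ z ≡ 0# → z ^ᴿ suc N ≡ z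
  power-residue d N q-1≡ z (inj₂ refl) = zeroˡ _
  power-residue d N q-1≡ z (inj₁ (y , y≢0 , refl)) = begin
    y ^ꟳ d ⊛ (y ^ꟳ d) ^ᴿ N     ≡⟨ cong (λ x → y ^ꟳ d ⊛ x ^ᴿ N) (^≡^ y d) ⟩
    y ^ꟳ d ⊛ (y ^ᴿ d) ^ᴿ N     ≡⟨ cong (y ^ꟳ d ⊛_) (trans (^-assocʳ y d N) (trans (cong (y ^ᴿ_) (sym q-1≡)) (fermat y y≢0))) ⟩
    y ^ꟳ d ⊛ 1#                ≡⟨ *-identityʳ _ ⟩
    y ^ꟳ d                     ∎
    where open ≡-Reasoning

  module Characteristic (p k : ℕ) (p-prime : Prime p) (q≡p^k : q ≡ p ^ k) where

    -- Its k-th power is q · 1 = 0, and a field has no nonzero nilpotents.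
    p·1≡0 : p · 1# ≡ 0#
    p·1≡0 with p · 1# ≟ 0#
    ... | yes p·1≡0 = p·1≡0
    ... | no  p·1≢0 = contradiction (trans (sym (power k)) (trans (cong (_· 1#) (sym q≡p^k)) q·1≡0)) (^-≉0 k p·1≢0)
      where
      power : ∀ k → (p ^ k) · 1# ≡ (p · 1#) ^ᴿ k
      power zero    = +-identityʳ 1#
      power (suc k) = trans (×1-homo-* p (p ^ k)) (cong ((p · 1#) ⊛_) (power k))

    multiple·1≡0 : ∀ m → (m * p) · 1# ≡ 0#
    multiple·1≡0 m = trans (×1-homo-* m p) (trans (cong ((m · 1#) ⊛_) p·1≡0) (zeroʳ _))

    ∣⇒·1≡0 : ∀ {n} → p ∣ n → n · 1# ≡ 0#
    ∣⇒·1≡0 (divides m refl) = multiple·1≡0 m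

    -- Over ℕ a Bézout identity makes a multiple of p and a multiple of n differ by 1. If n · 1 = 0,
    -- both are zero in the field, and 1 = 0 follows.
    ∤⇒·1≢0 : ∀ {n} → ¬ p ∣ n → ¬ n · 1# ≡ 0#
    ∤⇒·1≢0 {n} p∤n n·1≡0 = impossible (coprime-Bézout coprime)
      where
      coprime : Coprime p n
      coprime (i∣p , i∣n) with prime⇒irreducible p-prime i∣p
      ... | inj₁ i≡1  = i≡1
      ... | inj₂ refl = contradiction i∣n p∤n
      n-multiple·1≡0 : ∀ y → (y * n) · 1# ≡ 0#
      n-multiple·1≡0 y = trans (×1-homo-* y n) (trans (cong ((y · 1#) ⊛_) n·1≡0) (zeroʳ _))
      successive : ∀ m → (1 + m) · 1# ≡ 0# → ¬ m · 1# ≡ 0#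
      successive m 1+m·1≡0 m·1≡0 = 0≢1 (trans (sym 1+m·1≡0) (trans (cong (1# ⊕_) m·1≡0) (+-identityʳ 1#)))
      impossible : ¬ Bézout.Identity 1 p n
      impossible (Bézout.+- x y eq) = successive (y * n) (trans (cong (_· 1#) eq) (multiple·1≡0 x)) (n-multiple·1≡0 y)
      impossible (Bézout.-+ x y eq) = successive (x * p) (trans (cong (_· 1#) eq) (n-multiple·1≡0 y)) (multiple·1≡0 x)

-- Choice of R and the final contradiction.

half : ∀ w → ∃ λ h → h + h ≤ w × w ≤ suc (h + h)
half zero          = 0 , z≤n , z≤n
half (suc zero)    = 0 , z≤n , s≤s z≤n
half (suc (suc w)) with h , ≤w , w≤ ← half w =
  suc h , s≤s (subst (_≤ suc w) (sym (ℕ.+-suc h h)) (s≤s ≤w)) ,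
  s≤s (s≤s (subst (w ≤_) (sym (ℕ.+-suc h h)) w≤))

-- With R = h + 1 this is w ≤ 2R, hence 2N < w² ≤ 4R².
square-excess : ∀ N w h → 2 * N < w ^ 2 → w ≤ suc (h + h) → N < 2 * (suc h * suc h)
square-excess N w h 2N<w² w≤ = ℕ.*-cancelˡ-< 2 N _ (begin-strict
  2 * N                              <⟨ 2N<w² ⟩
  w ^ 2                              ≤⟨ ℕ.^-monoˡ-≤ 2 (ℕ.≤-trans w≤ (ℕ.n≤1+n _)) ⟩
  suc (suc (h + h)) ^ 2              ≡⟨ lemma h ⟩
  2 * (2 * (suc h * suc h))          ∎)
  where
  open ℕ.≤-Reasoning
  lemma : ∀ h → suc (suc (h + h)) * (suc (suc (h + h)) * 1) ≡ 2 * (2 * (suc h * suc h))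
  lemma = solve-∀

theorem4p7 : (d p k q : ℕ) → 2 ≤ d → Prime p → d ∣ (p ∸ 1) → 1 ≤ k → q ≡ p ^ k →
    (F : FiniteField q) → (lam : FiniteField.Carrier F) → ¬ (lam ≡ FiniteField.0# F) →
    (m : ℕ) (a : Fin m → FiniteField.Carrier F) → FiniteField.HasD F d lam m a →
    d * ((m ∸ 4) ^ 2) ≤ 2 * (q ∸ 1)
theorem4p7 d zero k q 2≤d p-prime = contradiction p-prime λ ()
theorem4p7 d (suc p′) (suc k′) q 2≤d p-prime (divides e p′≡ed) 1≤k q≡p^k F lam lam≢0 m a (a-inj , _ , aa+lam) =
  ℕ.≮⇒≥ λ big → let h , 2h≤w , w≤2h+1 = half (m ∸ 4) in
    no-excess (suc h) (size h (2N<w² big) 2h≤w) (square-excess N (m ∸ 4) h (2N<w² big) w≤2h+1)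
  where
  p = suc p′
  k = suc k′
  ε = repunit p k
  N = e * ε
  open FiniteFieldProperties F
  open Characteristic p k p-prime q≡p^k
  open ModPrime p′ p-prime using (p∤1; p∤*; module Exponents; exponents)
  open Exponents

  1≤e : 1 ≤ e
  1≤e = ℕ.n≢0⇒n>0 λ e≡0 → ℕ.nonTrivial⇒≢1 {{prime⇒nonTrivial p-prime}}
    (cong suc (trans p′≡ed (cong (_* d) e≡0)))

  2e≤p′ : e + e ≤ p′
  2e≤p′ = begin
    e + e    ≡⟨ lemma e ⟩
    e * 2    ≤⟨ ℕ.*-monoʳ-≤ e 2≤d ⟩
    e * d    ≡⟨ p′≡ed ⟨
    p′       ∎
    where
    open ℕ.≤-Reasoning
    lemma : ∀ e → e + e ≡ e * 2
    lemma = solve-∀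

  q-1≡dN : q ∸ 1 ≡ d * N
  q-1≡dN = begin
    q ∸ 1              ≡⟨ cong (_∸ 1) (trans q≡p^k (sym (repunit-^ p′ k))) ⟩
    p′ * ε + 1 ∸ 1     ≡⟨ ℕ.m+n∸n≡m (p′ * ε) 1 ⟩
    p′ * ε             ≡⟨ cong (_* ε) (trans p′≡ed (ℕ.*-comm e d)) ⟩
    d * e * ε          ≡⟨ ℕ.*-assoc d e ε ⟩
    d * N              ∎
    where open ≡-Reasoning

  p∤N : ¬ p ∣ N
  p∤N = p∤* {e} {ε} p∤e p∤ε
    where
    p∤e : ¬ p ∣ e
    p∤e p∣e = ℕ.<⇒≱ (s≤s (ℕ.≤-trans (ℕ.m≤m+n e e) 2e≤p′)) (∣⇒≤ {{ℕ.>-nonZero 1≤e}} p∣e)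
    p∤ε : ¬ p ∣ ε
    -- As k ≥ 1, p divides p^k = (p - 1) ε + 1, and would divide 1 if it divided ε.
    p∤ε p∣ε = p∤1 (∣m+n∣m⇒∣n (subst (p ∣_) (sym (repunit-^ p′ k)) (m∣m*n (p ^ k′))) (∣n⇒∣m*n p′ p∣ε))

  m≤q : m ≤ q
  m≤q = Fin.injective⇒≤ {f = index ∘ a} λ {i} {j} eq →
    a-inj i j (trans (sym (element-index (a i))) (trans (cong element eq) (element-index (a j))))

  2N<w² : 2 * (q ∸ 1) < d * (m ∸ 4) ^ 2 → 2 * N < (m ∸ 4) ^ 2
  2N<w² big = ℕ.*-cancelˡ-< d _ _ (subst (_< d * (m ∸ 4) ^ 2) (trans (cong (2 *_) q-1≡dN) (lemma d N)) big)
    where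
    lemma : ∀ d N → 2 * (d * N) ≡ d * (2 * N)
    lemma = solve-∀

  size : ∀ h → 2 * N < (m ∸ 4) ^ 2 → h + h ≤ m ∸ 4 → suc (suc (suc h + suc h)) ≤ m
  size h 2N<w² 2h≤w with 4 ℕ.≤? m
  ... | yes 4≤m = begin
    suc (suc (suc h + suc h))  ≡⟨ lemma h ⟩
    h + h + 4                  ≤⟨ ℕ.+-monoˡ-≤ 4 2h≤w ⟩
    m ∸ 4 + 4                  ≡⟨ ℕ.m∸n+n≡m 4≤m ⟩
    m                          ∎
    where
    open ℕ.≤-Reasoning
    lemma : ∀ h → suc (suc (suc h + suc h)) ≡ h + h + 4
    lemma = solve-∀
  -- For m < 4 the truncated m - 4 is 0, and no 2N lies below 0.
  ... | no  4≰m = contradiction (subst (λ w → 2 * N < w ^ 2) (ℕ.m≤n⇒m∸n≡0 (ℕ.<⇒≤ (ℕ.≰⇒> 4≰m))) 2N<w²) λ ()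

  no-excess : ∀ R → suc (suc (R + R)) ≤ m → ¬ N < 2 * (R * R)
  no-excess R 2R+2≤m N<2RR =
    Field.stepanov commutativeRing (FiniteField.inverse F) (FiniteField.0≢1 F ∘ sym)
      b (λ i j eq → b-inj i j (a-inj _ _ eq)) lam lam≢0 N
      (λ i j i≢j → power-residue d N q-1≡dN _ (aa+lam _ _ (i≢j ∘ b-inj i j)))
      (M X) (v X) (s X) (t X)
      (λ l l<R → Sum.map₂ ∣⇒·1≡0 (low-order X l l<R))
      (∤⇒·1≢0 (p∤C[t] X)) (∤⇒·1≢0 (p∤C[v] X)) (s+t≡1+2R X)
      (λ l t<l l≤ → ∣⇒·1≡0 (high-order X l t<l l≤)) (M+v+s≤2R X) (R≤v+s X)
      (begin-strict
        N + (R + R)                <⟨ ℕ.+-monoˡ-< (R + R) N<2RR ⟩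
        2 * (R * R) + (R + R)      ≡⟨ lemma R ⟩
        suc (suc (R + R)) * R      ∎)
    where
    open ℕ.≤-Reasoning
    lemma : ∀ R → 2 * (R * R) + (R + R) ≡ suc (suc (R + R)) * R
    lemma = solve-∀
    b = a ∘ λ i → inject≤ i 2R+2≤m
    b-inj : ∀ i j → inject≤ i 2R+2≤m ≡ inject≤ j 2R+2≤m → i ≡ j
    b-inj i j = Fin.inject≤-injective 2R+2≤m 2R+2≤m i j
    -- The given elements are distinct, so 2R + 2 ≤ q; thus R has at most k digits in base p, as N
    -- has.
    R<p^k : R < p ^ k
    R<p^k = begin-strict
      R                    <⟨ s≤s (ℕ.≤-trans (ℕ.m≤m+n R R) (ℕ.n≤1+n _)) ⟩
      suc (suc (R + R))    ≤⟨ 2R+2≤m ⟩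
      m                    ≤⟨ m≤q ⟩
      q                    ≡⟨ q≡p^k ⟩
      p ^ k                ∎
    X = exponents e 1≤e 2e≤p′ k R R<p^k p∤N
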